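{- For every integer $n$ with $6\le n\le 11$, there exists a graph of order $n$ and size $\mathrm{ex}(n,C_4)+1$ which contains exactly one copy of $C_4$. For $n=12$ and for $n=13$, the minimum number of copies of $C_4$ in a graph of order $n$ and size $\mathrm{ex}(n,C_4)+1$ is $2$.
   Context: All graphs are finite and simple. The order of a graph is its number of vertices and its size is its number of edges. $C_4$ denotes the cycle of length 4. A copy of $H$ in $G$ is a subgraph of $G$ isomorphic to $H$; the number of copies of $H$ in $G$ is the number of distinct subgraphs of $G$ isomorphic to $H$. For a graph $H$ and a positive integer $n$, the Turán number $\mathrm{ex}(n,H)$ is the maximum size of a simple graph of order $n$ containing no copy of $H$. (Known values: $\mathrm{ex}(6,C_4)=7$, $\mathrm{ex}(7,C_4)=9$, $\mathrm{ex}(8,C_4)=11$, $\mathrm{ex}(9,C_4)=13$, $\mathrm{ex}(10,C_4)=16$, $\mathrm{ex}(11,C_4)=18$, $\mathrm{ex}(12,C_4)=21$, $\mathrm{ex}(13,C_4)=24$.) -}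

module Defs where

open import Data.Bool.Base using (Bool; true; false)
open import Data.Fin.Base using (Fin; _<_)
open import Data.Fin.Patterns using (0F; 1F; 2F; 3F)
open import Data.Fin.Properties using (_≟_; _<?_; any?; all?)
open import Data.Fin.Subset using (Subset; _∈_; _∉_; ⁅_⁆; _∪_)
open import Data.Fin.Subset.Properties using (_∈?_)
open import Data.List.Base as List
  using (List; []; _∷_; [_]; length; filter; mapMaybe; allFin; cartesianProduct; cartesianProductWith)
import Data.List.Extrema.Nat as Extrema
import Data.List.Membership.Propositional as List∈
import Data.List.Membership.Propositional.Properties as List∈
open import Data.List.Membership.Propositional.Properties.WithK using (unique∧set⇒bag)
open import Data.List.Relation.Binary.BagAndSetEquality using (∼bag⇒↭)
open import Data.List.Relation.Binary.Permutation.Propositional.Properties using (↭-length)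
open import Data.List.Relation.Unary.All as All using ([]; _∷_)
open import Data.List.Relation.Unary.AllPairs using ([]; _∷_)
open import Data.List.Relation.Unary.Any as Any using (here; there)
open import Data.List.Relation.Unary.Unique.Propositional using (Unique)
import Data.List.Relation.Unary.Unique.Propositional.Properties as Unique
open import Data.Maybe.Base using (Maybe; just; nothing)
open import Data.Nat.Base using (ℕ; zero; suc; z≤n; _≤_)
open import Data.Nat.Properties using (≤-antisym)
open import Data.Product.Base using (∃; ∃-syntax; _×_; _,_; proj₁; proj₂; uncurry)
open import Data.Sum.Base using (inj₁; inj₂)
open import Data.Vec.Base using (Vec; []; _∷_; lookup; tabulate)
open import Data.Vec.Properties using (lookup∘tabulate; ∷-injective)
open import Function.Base using (_∘_)
open import Function.Bundles using (_⇔_; mk⇔; Equivalence)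
open import Function.Definitions using (Injective)
open import Level using (0ℓ)
open import Relation.Binary.Core using (Rel)
open import Relation.Binary.Definitions using (Decidable)
open import Relation.Binary.PropositionalEquality
  using (_≡_; _≗_; refl; sym; trans; subst; subst₂)
open import Relation.Nullary using (Dec; yes; no; ¬_; ¬?; contradiction)
open import Relation.Nullary.Decidable
  using (map′; _×-dec_; _→-dec_; from-yes; recompute)

private
  variable
    m n : ℕ
    A   : Set

-- Graphs on the vertex set Fin n, given by the neighbourhood of each vertex.
-- The laws are irrelevant, so graphs with the same neighbourhoods are
-- propositionally equal.
record Graph (n : ℕ) : Set where
  constructor mkGraph
  field
    nbhd        : Vec (Subset n) n
    .symmetric  : ∀ i j → j ∈ lookup nbhd i → i ∈ lookup nbhd j
    .loopless   : ∀ i → i ∉ lookup nbhd i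

Adj : Graph n → Rel (Fin n) 0ℓ
Adj G i j = j ∈ lookup (Graph.nbhd G) i

adj? : (G : Graph n) → Decidable (Adj G)
adj? G i j = j ∈? lookup (Graph.nbhd G) i

Edge : Graph n → Fin n × Fin n → Set
Edge G (i , j) = i < j × Adj G i j

edge? : (G : Graph n) (e : Fin n × Fin n) → Dec (Edge G e)
edge? G (i , j) = i <? j ×-dec adj? G i j

size : Graph n → ℕ
size {n} G = length (filter (edge? G) (cartesianProduct (allFin n) (allFin n)))

IsSimple : Vec (Subset n) n → Set
IsSimple N = (∀ i j → j ∈ lookup N i → i ∈ lookup N j) × (∀ i → i ∉ lookup N i)

isSimple? : (N : Vec (Subset n) n) → Dec (IsSimple N)
isSimple? N =
  all? (λ i → all? λ j → j ∈? lookup N i →-dec i ∈? lookup N j)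
    ×-dec all? (λ i → ¬? (i ∈? lookup N i))

C₄ : Graph 4
C₄ = mkGraph N (proj₁ simple) (proj₂ simple)
  where
  N : Vec (Subset 4) 4
  N = (⁅ 1F ⁆ ∪ ⁅ 3F ⁆) ∷ (⁅ 0F ⁆ ∪ ⁅ 2F ⁆) ∷ (⁅ 1F ⁆ ∪ ⁅ 3F ⁆) ∷ (⁅ 0F ⁆ ∪ ⁅ 2F ⁆) ∷ []

  simple : IsSimple N
  simple = from-yes (isSimple? N)

-- A pair (V , E) stands for the graph with vertex set V ⊆ Fin n and the edges
-- of E, provided that these have their ends in V; IsSubgraph demands this.
Part : ℕ → Set
Part n = Subset n × Graph n

IsSubgraph : Graph n → Part n → Set
IsSubgraph G (V , E) = ∀ i j → Adj E i j → Adj G i j × i ∈ V × j ∈ V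

IsIso : Graph m → Part n → (Fin m → Fin n) → Set
IsIso H (V , E) f =
  Injective _≡_ _≡_ f
  × (∀ v → v ∈ V ⇔ (∃[ i ] f i ≡ v))
  × (∀ i j → Adj H i j ⇔ Adj E (f i) (f j))

IsCopy : Graph m → Graph n → Part n → Set
IsCopy H G P = IsSubgraph G P × ∃ (IsIso H P)

Free : Graph m → Graph n → Set
Free H G = ¬ ∃ (IsCopy H G)

vecs : List A → (k : ℕ) → List (Vec A k)
vecs xs zero    = [ [] ]
vecs xs (suc k) = cartesianProductWith _∷_ xs (vecs xs k)

subsets : (n : ℕ) → List (Subset n)
subsets = vecs (true ∷ false ∷ [])

toGraph : Vec (Subset n) n → Maybe (Graph n)
toGraph N with isSimple? N
... | yes s = just (mkGraph N (proj₁ s) (proj₂ s))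
... | no  _ = nothing

graphs : (n : ℕ) → List (Graph n)
graphs n = mapMaybe toGraph (vecs (subsets n) n)

parts : (n : ℕ) → List (Part n)
parts n = cartesianProduct (subsets n) (graphs n)

∈-vecs : {xs : List A} → (∀ x → x List∈.∈ xs) → ∀ {k} (v : Vec A k) → v List∈.∈ vecs xs k
∈-vecs all∈ []      = here refl
∈-vecs all∈ (x ∷ v) = List∈.∈-cartesianProductWith⁺ _∷_ (all∈ x) (∈-vecs all∈ v)

vecs-unique : {xs : List A} → Unique xs → ∀ k → Unique (vecs xs k)
vecs-unique u zero    = [] ∷ []
vecs-unique u (suc k) = Unique.cartesianProductWith⁺ _∷_ ∷-injective u (vecs-unique u k)

∈-subsets : (V : Subset n) → V List∈.∈ subsets n
∈-subsets = ∈-vecs λ { true → here refl ; false → there (here refl) }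

subsets-unique : ∀ n → Unique (subsets n)
subsets-unique = vecs-unique (((λ ()) ∷ []) ∷ [] ∷ [])

private
  toGraph-nbhd : (N : Vec (Subset n) n) {G : Graph n} → toGraph N ≡ just G → Graph.nbhd G ≡ N
  toGraph-nbhd N eq with isSimple? N
  toGraph-nbhd N refl | yes _ = refl

  toGraph-complete : (G : Graph n) → toGraph (Graph.nbhd G) ≡ just G
  toGraph-complete (mkGraph N sy lo) with isSimple? N
  ... | yes _ = refl
  ... | no ¬s = contradiction (recompute (isSimple? N) (sy , lo)) ¬s

  ∈-mapMaybe⁺ : ∀ {N : Vec (Subset n) n} {G} Ns →
                N List∈.∈ Ns → toGraph N ≡ just G → G List∈.∈ mapMaybe toGraph Ns
  ∈-mapMaybe⁺ (N ∷ Ns) (here refl) eq rewrite eq = here refl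
  ∈-mapMaybe⁺ (N ∷ Ns) (there N∈) eq with toGraph N
  ... | just _  = there (∈-mapMaybe⁺ Ns N∈ eq)
  ... | nothing = ∈-mapMaybe⁺ Ns N∈ eq

  ∈-mapMaybe⁻ : ∀ {G : Graph n} Ns → G List∈.∈ mapMaybe toGraph Ns → Graph.nbhd G List∈.∈ Ns
  ∈-mapMaybe⁻ (N ∷ Ns) G∈ with toGraph N in eq
  ∈-mapMaybe⁻ (N ∷ Ns) (here refl) | just _  = here (toGraph-nbhd N eq)
  ∈-mapMaybe⁻ (N ∷ Ns) (there G∈)  | just _  = there (∈-mapMaybe⁻ Ns G∈)
  ∈-mapMaybe⁻ (N ∷ Ns) G∈          | nothing = there (∈-mapMaybe⁻ Ns G∈)

  mapMaybe-unique : ∀ {Ns : List (Vec (Subset n) n)} → Unique Ns → Unique (mapMaybe toGraph Ns)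
  mapMaybe-unique [] = []
  mapMaybe-unique {Ns = N ∷ Ns} (N∉ ∷ u) with toGraph N in eq
  ... | nothing = mapMaybe-unique u
  ... | just G  =
    All.tabulate (λ { G∈ refl →
      All.lookup N∉ (∈-mapMaybe⁻ Ns G∈) (sym (toGraph-nbhd N eq)) })
    ∷ mapMaybe-unique u

∈-graphs : (G : Graph n) → G List∈.∈ graphs n
∈-graphs G = ∈-mapMaybe⁺ _ (∈-vecs ∈-subsets (Graph.nbhd G)) (toGraph-complete G)

graphs-unique : ∀ n → Unique (graphs n)
graphs-unique n = mapMaybe-unique (vecs-unique (subsets-unique n) n)

∈-parts : (P : Part n) → P List∈.∈ parts n
∈-parts (V , E) = List∈.∈-cartesianProduct⁺ (∈-subsets V) (∈-graphs E)

parts-unique : ∀ n → Unique (parts n)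
parts-unique n = Unique.cartesianProduct⁺ (subsets-unique n) (graphs-unique n)

private
  infixr 2 _⇔-dec_

  _⇔-dec_ : {A B : Set} → Dec A → Dec B → Dec (A ⇔ B)
  a? ⇔-dec b? =
    map′ (uncurry mk⇔) (λ e → Equivalence.to e , Equivalence.from e)
         ((a? →-dec b?) ×-dec (b? →-dec a?))

  isIso-resp : (H : Graph m) (P : Part n) {f g : Fin m → Fin n} →
               f ≗ g → IsIso H P f → IsIso H P g
  isIso-resp H (V , E) f≗g (inj , img , adj) =
      (λ {i} {j} eq → inj (trans (f≗g i) (trans eq (sym (f≗g j)))))
    , (λ v → mk⇔
        (λ v∈ → let (i , eq) = Equivalence.to (img v) v∈ in i , trans (sym (f≗g i)) eq)
        (λ (i , eq) → Equivalence.from (img v) (i , trans (f≗g i) eq)))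
    , (λ i j → subst₂ (λ x y → Adj H i j ⇔ Adj E x y) (f≗g i) (f≗g j) (adj i j))

isSubgraph? : (G : Graph n) (P : Part n) → Dec (IsSubgraph G P)
isSubgraph? G (V , E) =
  all? λ i → all? λ j → adj? E i j →-dec (adj? G i j ×-dec i ∈? V ×-dec j ∈? V)

isIso? : (H : Graph m) (P : Part n) (f : Fin m → Fin n) → Dec (IsIso H P f)
isIso? H (V , E) f =
  map′ (λ inj {i} {j} → inj i j) (λ inj i j → inj {i} {j})
       (all? λ i → all? λ j → f i ≟ f j →-dec i ≟ j)
  ×-dec (all? λ v → v ∈? V ⇔-dec any? (λ i → f i ≟ v))
  ×-dec (all? λ i → all? λ j → adj? H i j ⇔-dec adj? E (f i) (f j))

iso? : (H : Graph m) (P : Part n) → Dec (∃ (IsIso H P))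
iso? {m} {n} H P =
  map′ (λ any → let (v , iso) = Any.satisfied any in lookup v , iso)
       (λ (f , iso) → List∈.lose (∈-vecs List∈.∈-allFin (tabulate f))
                                 (isIso-resp H P (sym ∘ lookup∘tabulate f) iso))
       (Any.any? (λ v → isIso? H P (lookup v)) (vecs (allFin n) m))

isCopy? : (H : Graph m) (G : Graph n) (P : Part n) → Dec (IsCopy H G P)
isCopy? H G P = isSubgraph? G P ×-dec iso? H P

free? : (H : Graph m) (G : Graph n) → Dec (Free H G)
free? {n = n} H G =
  ¬? (map′ Any.satisfied (λ (P , c) → List∈.lose (∈-parts P) c)
           (Any.any? (isCopy? H G) (parts n)))

-- Both functions search lists of astronomical length; opacity keeps the type
-- checker from evaluating them.
opaque
  #copies : Graph m → Graph n → ℕ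
  #copies {n = n} H G = length (filter (isCopy? H G) (parts n))

  -- Takes the value 0 if every graph of order n contains a copy of H, which
  -- is impossible as soon as H has an edge.
  ex : ℕ → Graph m → ℕ
  ex n H = Extrema.max 0 (List.map size (filter (free? H) (graphs n)))

opaque
  unfolding #copies

  #copies-spec : (H : Graph m) (G : Graph n) {Ps : List (Part n)} → Unique Ps →
                 (∀ P → P List∈.∈ Ps ⇔ IsCopy H G P) → #copies H G ≡ length Ps
  #copies-spec {n = n} H G {Ps} u spec =
    ↭-length (∼bag⇒↭ (unique∧set⇒bag (Unique.filter⁺ (isCopy? H G) (parts-unique n)) u
      λ {P} → mk⇔
        (λ P∈ → Equivalence.from (spec P)
                  (proj₂ (List∈.∈-filter⁻ (isCopy? H G) {xs = parts n} P∈)))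
        (λ P∈ → List∈.∈-filter⁺ (isCopy? H G) (∈-parts P) (Equivalence.to (spec P) P∈))))

opaque
  unfolding ex

  ex-upper : (H : Graph m) (G : Graph n) → Free H G → size G ≤ ex n H
  ex-upper H G free =
    All.lookup (Extrema.xs≤max 0 _)
      (List∈.∈-map⁺ size (List∈.∈-filter⁺ (free? H) (∈-graphs G) free))

  ex-attained : (H : Graph m) (G : Graph n) → Free H G →
                ∃[ G′ ] Free H G′ × size {n} G′ ≡ ex n H
  ex-attained {n = n} H G free
    with Extrema.argmax-sel (λ k → k) 0 (List.map size (filter (free? H) (graphs n)))
  ... | inj₁ ex≡0 =
    G , free , ≤-antisym (ex-upper H G free) (subst (_≤ size G) (sym ex≡0) z≤n)
  ... | inj₂ ex∈ =
    let (G′ , G′∈ , ex≡) = List∈.∈-map⁻ size ex∈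
    in  G′ , proj₂ (List∈.∈-filter⁻ (free? H) {xs = graphs n} G′∈) , sym ex≡

IsMinimum : (ℕ → Set) → ℕ → Set
IsMinimum P k = P k × (∀ j → P j → k ≤ j)

{-# OPTIONS --safe #-}

-- Deleting a vertex of at most average degree from a graph with many edges and
-- at most one C₄ leaves a graph of the same kind. So the graphs on n ≤ 13
-- vertices with at most one C₄ and at least threshold n edges can be
-- classified up to isomorphism, by adding one vertex at a time and discarding
-- the extensions with a second C₄. No such graph has 22 edges on 12 vertices
-- or 25 edges on 13 vertices, and for 6 ≤ n ≤ 11 those with more than turán n
-- edges contain a C₄. The extremal graphs are induced subgraphs of the polarity
-- graph of the projective plane of order 3, and one more edge creates no more
-- than the claimed number of copies of C₄.
module Submission where

open import Defs
open import Data.Bool using (Bool; true; false; T; _∧_; _∨_; if_then_else_)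
import Data.Bool.ListAction as Bool
import Data.Bool.Properties as Bool
open import Data.Empty using (⊥-elim)
open import Data.Fin as Fin using (Fin; zero; suc)
import Data.Fin.Properties as Fin
open import Data.Fin.Patterns using (0F; 1F; 2F; 3F)
open import Data.Fin.Permutation as Perm using (Permutation; permutation; _⟨$⟩ʳ_; _⟨$⟩ˡ_; _∘ₚ_; lift₀; inverseˡ)
open import Data.Fin.Subset using (Subset)
import Data.Fin.Subset.Properties as Subset
open import Data.List as List using (List; []; _∷_; length; filter; cartesianProduct; concatMap)
import Data.List.Properties as List
open import Data.List.Membership.Propositional using (_∈_)
import Data.List.Membership.Propositional.Properties as List∈
open import Data.List.Relation.Unary.All as All using (All; []; _∷_)
import Data.List.Relation.Unary.All.Properties as All
open import Data.List.Relation.Unary.Any as Any using (here; there)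
open import Data.List.Relation.Unary.Unique.Propositional using (Unique)
import Data.List.Relation.Unary.Unique.Propositional.Properties as Unique
import Data.List.Relation.Unary.Unique.DecPropositional as UniqueDec
open import Data.Nat
import Data.Nat.Properties as ℕ
open import Data.Nat.Tactic.RingSolver using (solve-∀)
open import Data.Product using (∃; ∃-syntax; ∃₂; _×_; _,_; proj₁; proj₂)
import Data.Product.Properties as Product
open import Data.Sum using (_⊎_; inj₁; inj₂)
open import Data.Unit using (tt)
open import Data.Vec as Vec using (Vec; []; _∷_; lookup; tabulate; zipWith)
import Data.Vec.Properties as Vec
open import Function using (_∘_; _⇔_; mk⇔; Injective; case_of_; Equivalence)
open import Relation.Binary.PropositionalEquality
open import Relation.Nullary using (Dec; yes; no; does; ¬_; contradiction; ¬?)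
open import Relation.Nullary.Decidable using (map′; _×-dec_; _→-dec_; toWitness; True; recompute; dec-true)

open import Algebra.Properties.CommutativeMonoid.Sum ℕ.+-0-commutativeMonoid
  using (sum; sum-cong-≗; ∑-distrib-+; ∑-permute)

open Equivalence using (to; from)

-- The value of ex(n,C₄) and the number of forced copies come out of one classification: a C₄-free
-- graph has in particular at most one C₄, so the same lists bound ex(n,C₄) from above. The search
-- is carried out by evaluation during type checking, and this shapes the encoding: graphs are
-- triangular arrays of booleans, new 4-cycles are counted through codegrees, and rows are pruned
-- while they are being built. Soundness asks only that no graph be missing from a list, so the
-- normal form that merges isomorphic copies may be a heuristic. The case n = 13 rests on n = 12: a
-- graph with 25 edges on 13 vertices has a vertex of degree at most 3, and its deletion leaves at
-- least 22 edges on 12 vertices.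

private
  variable
    m n : ℕ
    A B : Set

-- Adjacency matrices, degrees and numbers of edges

Matrix : ℕ → Set
Matrix n = Fin n → Fin n → Bool

record IsSimpleMatrix (M : Matrix n) : Set where
  field
    symmetric : ∀ i j → M i j ≡ M j i
    loopless  : ∀ i → M i i ≡ false

open IsSimpleMatrix

restrict : Matrix n → (Fin m → Fin n) → Matrix m
restrict M f i j = M (f i) (f j)

restrict-simple : {M : Matrix n} → IsSimpleMatrix M →
                  (f : Fin m → Fin n) → IsSimpleMatrix (restrict M f)
restrict-simple s f = record
  { symmetric = λ i j → symmetric s (f i) (f j)
  ; loopless  = λ i → loopless s (f i)
  }

𝟙 : Bool → ℕ
𝟙 b = if b then 1 else 0

degree : Matrix n → Fin n → ℕ
degree M i = sum λ j → 𝟙 (M i j)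

degreeSum : Matrix n → ℕ
degreeSum M = sum (degree M)

-- Counting row by row above the diagonal makes the deletion of vertex 0 a definitional equation, on
-- which `step-complete` relies.
edges : Matrix n → ℕ
edges {zero}  M = 0
edges {suc n} M = sum (λ j → 𝟙 (M zero (suc j))) + edges (restrict M suc)

edges-cong : {M N : Matrix n} → (∀ i j → M i j ≡ N i j) → edges M ≡ edges N
edges-cong {zero}  eq = refl
edges-cong {suc n} eq =
  cong₂ _+_ (sum-cong-≗ λ j → cong 𝟙 (eq zero (suc j))) (edges-cong λ i j → eq (suc i) (suc j))

handshake : {M : Matrix n} → IsSimpleMatrix M → degreeSum M ≡ edges M + edges M
handshake {zero}  s = refl
handshake {suc n} {M} s = begin
  (𝟙 (M zero zero) + d) + sum (λ i → 𝟙 (M (suc i) zero) + degree N i)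
    ≡⟨ cong₂ (λ b x → (𝟙 b + d) + x) (loopless s zero) (∑-distrib-+ _ (degree N)) ⟩
  d + (sum (λ i → 𝟙 (M (suc i) zero)) + degreeSum N)
    ≡⟨ cong (d +_) (cong₂ _+_ (sum-cong-≗ λ i → cong 𝟙 (symmetric s (suc i) zero))
                              (handshake (restrict-simple s suc))) ⟩
  d + (d + (edges N + edges N))
    ≡⟨ shuffle d (edges N) ⟩
  (d + edges N) + (d + edges N) ∎
  where
  open ≡-Reasoning
  N = restrict M suc
  d = sum (λ j → 𝟙 (M zero (suc j)))

  shuffle : ∀ x y → x + (x + (y + y)) ≡ (x + y) + (x + y)
  shuffle = solve-∀

degree-permute : (M : Matrix n) (π : Permutation n n) (i : Fin n) →
                 degree (restrict M (π ⟨$⟩ʳ_)) i ≡ degree M (π ⟨$⟩ʳ i)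
degree-permute M π i = sym (∑-permute (λ j → 𝟙 (M (π ⟨$⟩ʳ i) j)) π)

+-self-injective : ∀ {x y} → x + x ≡ y + y → x ≡ y
+-self-injective {x} {y} eq = ℕ.*-cancelˡ-≡ x y 2
  (trans (cong (x +_) (ℕ.+-identityʳ x)) (trans eq (cong (y +_) (sym (ℕ.+-identityʳ y)))))

-- The recursion behind `edges` depends on the order of the vertices, the degree sum does not;
-- `handshake` carries its invariance over.
edges-permute : {M : Matrix n} → IsSimpleMatrix M → (π : Permutation n n) →
                edges (restrict M (π ⟨$⟩ʳ_)) ≡ edges M
edges-permute {M = M} s π = +-self-injective (begin
  edges N + edges N                  ≡⟨ handshake {M = N} (restrict-simple s (π ⟨$⟩ʳ_)) ⟨
  degreeSum N                        ≡⟨ sum-cong-≗ (degree-permute M π) ⟩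
  sum (λ i → degree M (π ⟨$⟩ʳ i))    ≡⟨ ∑-permute (degree M) π ⟨
  degreeSum M                        ≡⟨ handshake s ⟩
  edges M + edges M                  ∎)
  where
  open ≡-Reasoning
  N = restrict M (π ⟨$⟩ʳ_)

∃-≤-average : (f : Fin (suc n) → ℕ) → ∃ λ i → suc n * f i ≤ sum f
∃-≤-average {zero}  f = zero , ℕ.≤-refl
∃-≤-average {suc n} f with ∃-≤-average (f ∘ suc)
... | i , le with f zero ≤? f (suc i)
...   | yes f₀≤ = zero , ℕ.+-monoʳ-≤ (f zero) (ℕ.≤-trans (ℕ.*-monoʳ-≤ (suc n) f₀≤) le)
...   | no  f₀≰ = suc i , ℕ.+-mono-≤ (ℕ.≰⇒≥ f₀≰) le

-- Triangular arrays: the row in front of a Tri A n belongs to a new index 0.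
data Tri (A : Set) : ℕ → Set where
  []  : Tri A 0
  _∷_ : Vec A n → Tri A n → Tri A (suc n)

adj : Tri Bool n → Matrix n
adj (r ∷ g) zero    zero    = false
adj (r ∷ g) zero    (suc j) = lookup r j
adj (r ∷ g) (suc i) zero    = lookup r i
adj (r ∷ g) (suc i) (suc j) = adj g i j

adj-simple : (g : Tri Bool n) → IsSimpleMatrix (adj g)
adj-simple g = record { symmetric = sy g ; loopless = lo g }
  where
  sy : ∀ {n} (g : Tri Bool n) i j → adj g i j ≡ adj g j i
  sy (r ∷ g) zero    zero    = refl
  sy (r ∷ g) zero    (suc j) = refl
  sy (r ∷ g) (suc i) zero    = refl
  sy (r ∷ g) (suc i) (suc j) = sy g i j

  lo : ∀ {n} (g : Tri Bool n) i → adj g i i ≡ false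
  lo (r ∷ g) zero    = refl
  lo (r ∷ g) (suc i) = lo g i

trues : Vec Bool n → ℕ
trues []          = 0
trues (true ∷ r)  = suc (trues r)
trues (false ∷ r) = trues r

trues≡sum : (r : Vec Bool n) → trues r ≡ sum (λ i → 𝟙 (lookup r i))
trues≡sum []          = refl
trues≡sum (true ∷ r)  = cong suc (trues≡sum r)
trues≡sum (false ∷ r) = trues≡sum r

#edges : Tri Bool n → ℕ
#edges []      = 0
#edges (r ∷ g) = trues r + #edges g

#edges≡edges : (g : Tri Bool n) → #edges g ≡ edges (adj g)
#edges≡edges []      = refl
#edges≡edges (r ∷ g) = cong₂ _+_ (trues≡sum r) (#edges≡edges g)

-- 4-cycles

-- This is a parametrised 4-cycle: each copy of C₄ has eight of them. `CycleEdge` forgets the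
-- parametrisation.
IsCycle : Matrix n → (Fin 4 → Fin n) → Set
IsCycle M f = Injective _≡_ _≡_ f × (∀ i j → Adj C₄ i j → M (f i) (f j) ≡ true)

HasCycle : Matrix n → Set
HasCycle M = ∃ (IsCycle M)

CycleEdge : (Fin 4 → Fin n) → Fin n → Fin n → Set
CycleEdge f x y = ∃₂ λ i j → Adj C₄ i j × f i ≡ x × f j ≡ y

-- At most one copy of C₄, expressed without counting. One inclusion of edge sets is enough, since
-- `f` and `g` can be exchanged.
OneCycle : Matrix n → Set
OneCycle M = ∀ f g → IsCycle M f → IsCycle M g → ∀ x y → CycleEdge f x y → CycleEdge g x y

cycle-∘ : {M : Matrix n} {N : Matrix m} (p : Fin m → Fin n) → Injective _≡_ _≡_ p →
          (∀ i j → N i j ≡ M (p i) (p j)) → ∀ f → IsCycle N f → IsCycle M (p ∘ f)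
cycle-∘ p p-inj eq f (f-inj , f-adj) = f-inj ∘ p-inj , λ i j a → trans (sym (eq _ _)) (f-adj i j a)

oneCycle-∘ : {M : Matrix n} {N : Matrix m} (p : Fin m → Fin n) → Injective _≡_ _≡_ p →
             (∀ i j → N i j ≡ M (p i) (p j)) → OneCycle M → OneCycle N
oneCycle-∘ {M = M} p p-inj eq one f g fc gc x y (i , j , a , fi , fj)
  with one (p ∘ f) (p ∘ g) (cycle-∘ {M = M} p p-inj eq f fc) (cycle-∘ {M = M} p p-inj eq g gc) (p x) (p y)
           (i , j , a , cong p fi , cong p fj)
... | i′ , j′ , a′ , gi , gj = i′ , j′ , a′ , p-inj gi , p-inj gj

square : Fin n → Fin n → Fin n → Fin n → Fin 4 → Fin n
square a b c d = lookup (a ∷ b ∷ c ∷ d ∷ [])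

adjacent-≢ : {M : Matrix n} → IsSimpleMatrix M → ∀ {i j} → M i j ≡ true → i ≢ j
adjacent-≢ s {i} e refl = case trans (sym e) (loopless s i) of λ ()

-- The hypotheses present a 4-cycle as two common neighbours `b` and `d` of `a` and `c`. Only the
-- two diagonals need explicit inequalities, as adjacent vertices differ anyway.
square-cycle : {M : Matrix n} → IsSimpleMatrix M → ∀ {a b c d} →
               M a b ≡ true → M c b ≡ true → M a d ≡ true → M c d ≡ true →
               a ≢ c → b ≢ d → IsCycle M (square a b c d)
square-cycle {M = M} s {a} {b} {c} {d} ab cb ad cd a≢c b≢d = inj , edge
  where
  flip : ∀ {x y} → M x y ≡ true → M y x ≡ true
  flip {x} {y} = trans (symmetric s y x)

  ≢ : ∀ {x y} → M x y ≡ true → x ≢ y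
  ≢ = adjacent-≢ {M = M} s

  inj : Injective _≡_ _≡_ (square a b c d)
  inj {0F} {0F} _ = refl
  inj {0F} {1F} e = contradiction e (≢ ab)
  inj {0F} {2F} e = contradiction e a≢c
  inj {0F} {3F} e = contradiction e (≢ ad)
  inj {1F} {0F} e = contradiction (sym e) (≢ ab)
  inj {1F} {1F} _ = refl
  inj {1F} {2F} e = contradiction (sym e) (≢ cb)
  inj {1F} {3F} e = contradiction e b≢d
  inj {2F} {0F} e = contradiction (sym e) a≢c
  inj {2F} {1F} e = contradiction e (≢ cb)
  inj {2F} {2F} _ = refl
  inj {2F} {3F} e = contradiction e (≢ cd)
  inj {3F} {0F} e = contradiction (sym e) (≢ ad)
  inj {3F} {1F} e = contradiction (sym e) b≢d
  inj {3F} {2F} e = contradiction (sym e) (≢ cd)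
  inj {3F} {3F} _ = refl

  edge : ∀ i j → Adj C₄ i j → M (square a b c d i) (square a b c d j) ≡ true
  edge 0F 1F _ = ab
  edge 0F 3F _ = ad
  edge 1F 0F _ = flip ab
  edge 1F 2F _ = flip cb
  edge 2F 1F _ = cb
  edge 2F 3F _ = cd
  edge 3F 0F _ = flip ad
  edge 3F 2F _ = flip cd
  edge 0F 0F ()
  edge 0F 2F (Vec.there (Vec.there ()))
  edge 1F 1F (Vec.there ())
  edge 1F 3F (Vec.there (Vec.there (Vec.there ())))
  edge 2F 0F ()
  edge 2F 2F (Vec.there (Vec.there ()))
  edge 3F 1F (Vec.there ())
  edge 3F 3F (Vec.there (Vec.there (Vec.there ())))

C₄-nbrs-0 : ∀ j → Adj C₄ 0F j → j ≡ 1F ⊎ j ≡ 3F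
C₄-nbrs-0 1F _ = inj₁ refl
C₄-nbrs-0 3F _ = inj₂ refl
C₄-nbrs-0 0F ()
C₄-nbrs-0 2F (Vec.there (Vec.there ()))

C₄-nbrs-1 : ∀ j → Adj C₄ 1F j → j ≡ 0F ⊎ j ≡ 2F
C₄-nbrs-1 0F _ = inj₁ refl
C₄-nbrs-1 2F _ = inj₂ refl
C₄-nbrs-1 1F (Vec.there ())
C₄-nbrs-1 3F (Vec.there (Vec.there (Vec.there ())))

nbrs-0 : {f : Fin 4 → Fin n} → Injective _≡_ _≡_ f →
         ∀ {y} → CycleEdge f (f 0F) y → y ≡ f 1F ⊎ y ≡ f 3F
nbrs-0 {f = f} inj (i , j , a , fi , fj) with inj fi
... | refl with C₄-nbrs-0 j a
...   | inj₁ refl = inj₁ (sym fj)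
...   | inj₂ refl = inj₂ (sym fj)

nbrs-1 : {f : Fin 4 → Fin n} → Injective _≡_ _≡_ f →
         ∀ {y} → CycleEdge f (f 1F) y → y ≡ f 0F ⊎ y ≡ f 2F
nbrs-1 {f = f} inj (i , j , a , fi , fj) with inj fi
... | refl with C₄-nbrs-1 j a
...   | inj₁ refl = inj₁ (sym fj)
...   | inj₂ refl = inj₂ (sym fj)

-- The 4-cycles of adj (r ∷ g) through the new vertex.
record Spoke (r : Vec Bool n) (g : Tri Bool n) (s t w : Fin n) : Set where
  constructor spoke
  field
    s<t : s Fin.< t
    rs  : lookup r s ≡ true
    rt  : lookup r t ≡ true
    sw  : adj g s w ≡ true
    tw  : adj g t w ≡ true

module _ {r : Vec Bool n} {g : Tri Bool n} where

  spoke-square : (s t w : Fin n) → Fin 4 → Fin (suc n)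
  spoke-square s t w = square zero (suc s) (suc w) (suc t)

  spoke-cycle : ∀ {s t w} → Spoke r g s t w → IsCycle (adj (r ∷ g)) (spoke-square s t w)
  spoke-cycle {s} {t} {w} (spoke s<t rs rt sw tw) =
    square-cycle (adj-simple (r ∷ g)) {zero} {suc s} {suc w} {suc t}
      rs (trans (symmetric (adj-simple g) w s) sw)
      rt (trans (symmetric (adj-simple g) w t) tw)
      (λ ()) (Fin.<⇒≢ s<t ∘ Fin.suc-injective)

  -- The cycle edges at the new vertex determine the pair of `s` and `t`, the order `s < t` tells
  -- them apart, and the other cycle edge at `s` determines `w`.
  spoke-unique : OneCycle (adj (r ∷ g)) → ∀ {s t w s′ t′ w′} →
                 Spoke r g s t w → Spoke r g s′ t′ w′ → s ≡ s′ × t ≡ t′ × w ≡ w′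
  spoke-unique one {s} {t} {w} {s′} {t′} {w′} p p′ = conclude (end c0s) (end c0t)
    where
    f = spoke-square s t w
    f′ = spoke-square s′ t′ w′

    transfer : ∀ {x y} → CycleEdge f x y → CycleEdge f′ x y
    transfer = one f f′ (spoke-cycle p) (spoke-cycle p′) _ _

    inj′ : Injective _≡_ _≡_ f′
    inj′ = proj₁ (spoke-cycle p′)

    c0s : CycleEdge f′ zero (suc s)
    c0s = transfer (0F , 1F , Vec.there Vec.here , refl , refl)

    c0t : CycleEdge f′ zero (suc t)
    c0t = transfer (0F , 3F , Vec.there (Vec.there (Vec.there Vec.here)) , refl , refl)

    csw : CycleEdge f′ (suc s) (suc w)
    csw = transfer (1F , 2F , Vec.there (Vec.there Vec.here) , refl , refl)

    end : ∀ {x} → CycleEdge f′ zero (suc x) → x ≡ s′ ⊎ x ≡ t′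
    end e with nbrs-0 {f = f′} inj′ e
    ... | inj₁ eq = inj₁ (Fin.suc-injective eq)
    ... | inj₂ eq = inj₂ (Fin.suc-injective eq)

    conclude : s ≡ s′ ⊎ s ≡ t′ → t ≡ s′ ⊎ t ≡ t′ → s ≡ s′ × t ≡ t′ × w ≡ w′
    conclude (inj₁ refl) (inj₁ refl) = contradiction refl (Fin.<⇒≢ (Spoke.s<t p))
    conclude (inj₂ refl) (inj₂ refl) = contradiction refl (Fin.<⇒≢ (Spoke.s<t p))
    conclude (inj₂ refl) (inj₁ refl) = contradiction (Spoke.s<t p) (Fin.<-asym (Spoke.s<t p′))
    -- On the second cycle `suc s′` has the neighbours `zero` and `suc w′`, and `suc w` is not
    -- `zero`.
    conclude (inj₁ refl) (inj₂ refl) with nbrs-1 {f = f′} inj′ csw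
    ... | inj₂ eq = refl , refl , Fin.suc-injective eq

  spoke⇒no-old-cycle : OneCycle (adj (r ∷ g)) → ∀ {s t w} →
                       Spoke r g s t w → ¬ HasCycle (adj g)
  spoke⇒no-old-cycle one p (f , fc)
    with one _ (suc ∘ f) (spoke-cycle p)
           (cycle-∘ {M = adj (r ∷ g)} suc Fin.suc-injective (λ _ _ → refl) f fc) zero (suc _)
           (0F , 1F , Vec.there Vec.here , refl , refl)
  ... | _ , _ , _ , () , _

-- Codegrees and 4-cycles through a new vertex

at : Tri A n → (i j : Fin n) → i Fin.< j → A
at (r ∷ C) zero    (suc j) _ = lookup r j
at (r ∷ C) (suc i) (suc j) p = at C i j (s≤s⁻¹ p)

upper : (A → A → B) → Vec A n → Tri B n
upper f []       = []
upper f (x ∷ xs) = Vec.map (f x) xs ∷ upper f xs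

at-upper : (f : A → A → B) (xs : Vec A n) → ∀ i j (p : i Fin.< j) →
           at (upper f xs) i j p ≡ f (lookup xs i) (lookup xs j)
at-upper f (x ∷ xs) zero    (suc j) _ = Vec.lookup-map j (f x) xs
at-upper f (x ∷ xs) (suc i) (suc j) p = at-upper f xs i j (s≤s⁻¹ p)

rows : Tri Bool n → Vec (Vec Bool n) n
rows []      = []
rows (r ∷ g) = (false ∷ r) ∷ zipWith _∷_ r (rows g)

lookup-rows : (g : Tri Bool n) → ∀ i j → lookup (lookup (rows g) i) j ≡ adj g i j
lookup-rows (r ∷ g) zero    zero    = refl
lookup-rows (r ∷ g) zero    (suc j) = refl
lookup-rows (r ∷ g) (suc i) j       = trans
  (cong (λ v → lookup v j) (Vec.lookup-zipWith _∷_ i r (rows g)))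
  (go j)
  where
  go : ∀ j → lookup (lookup r i ∷ lookup (rows g) i) j ≡ adj (r ∷ g) (suc i) j
  go zero    = refl
  go (suc j) = lookup-rows g i j

common : Vec Bool n → Vec Bool n → ℕ
common x y = trues (zipWith _∧_ x y)

codegrees : Tri Bool n → Tri ℕ n
codegrees g = upper common (rows g)

trues-pos : (r : Vec Bool n) → 0 < trues r → ∃ λ i → lookup r i ≡ true
trues-pos (true  ∷ r) _ = zero , refl
trues-pos (false ∷ r) p = let (i , e) = trues-pos r p in suc i , e

trues->1 : (r : Vec Bool n) → 1 < trues r →
           ∃₂ λ i j → i ≢ j × lookup r i ≡ true × lookup r j ≡ true
trues->1 (true  ∷ r) (s≤s p) =
  let (i , e) = trues-pos r p in zero , suc i , (λ ()) , refl , e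
trues->1 (false ∷ r) p =
  let (i , j , i≢j , ei , ej) = trues->1 r p
  in  suc i , suc j , i≢j ∘ Fin.suc-injective , ei , ej

∧-true : ∀ {x y} → x ∧ y ≡ true → x ≡ true × y ≡ true
∧-true {true} {true} _ = refl , refl

module _ (g : Tri Bool n) {i j : Fin n} (i<j : i Fin.< j) where

  private
    v : Vec Bool n
    v = zipWith _∧_ (lookup (rows g) i) (lookup (rows g) j)

    codegree : ℕ
    codegree = at (codegrees g) i j i<j

    codegree≡ : codegree ≡ trues v
    codegree≡ = at-upper common (rows g) i j i<j

    nbrs : ∀ {w} → lookup v w ≡ true → adj g i w ≡ true × adj g j w ≡ true
    nbrs {w} e =
      let (ei , ej) = ∧-true (trans (sym (Vec.lookup-zipWith _∧_ w (lookup (rows g) i) (lookup (rows g) j))) e)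
      in  trans (sym (lookup-rows g i w)) ei , trans (sym (lookup-rows g j w)) ej

  codegree-pos : 0 < codegree → ∃ λ w → adj g i w ≡ true × adj g j w ≡ true
  codegree-pos p = let (w , e) = trues-pos v (subst (0 <_) codegree≡ p) in w , nbrs e

  codegree->1 : 1 < codegree →
                ∃₂ λ w w′ → w ≢ w′ × (adj g i w ≡ true × adj g j w ≡ true)
                                   × (adj g i w′ ≡ true × adj g j w′ ≡ true)
  codegree->1 p =
    let (w , w′ , w≢w′ , e , e′) = trues->1 v (subst (1 <_) codegree≡ p)
    in  w , w′ , w≢w′ , nbrs e , nbrs e′

anyBig : Vec ℕ n → Bool
anyBig []      = false
anyBig (c ∷ r) = (1 <ᵇ c) ∨ anyBig r

hasBig : Tri ℕ n → Bool
hasBig []      = false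
hasBig (r ∷ C) = anyBig r ∨ hasBig C

anyBig-sound : (r : Vec ℕ n) → T (anyBig r) → ∃ λ j → 1 < lookup r j
anyBig-sound (c ∷ r) p with 1 <ᵇ c in eq
... | true  = zero , ℕ.<ᵇ⇒< 1 c (subst T (sym eq) tt)
... | false = let (j , q) = anyBig-sound r p in suc j , q

hasBig-sound : (C : Tri ℕ n) → T (hasBig C) → ∃₂ λ i j → ∃ λ p → 1 < at C i j p
hasBig-sound (r ∷ C) p with anyBig r in eq
... | true  = let (j , q) = anyBig-sound r (subst T (sym eq) tt) in zero , suc j , s≤s z≤n , q
... | false = let (i , j , i<j , q) = hasBig-sound C p in suc i , suc j , s≤s i<j , q

-- A codegree above 1 means two common neighbours, hence a C₄ in which `i` and `j` are opposite.
hasBig⇒hasCycle : (g : Tri Bool n) → T (hasBig (codegrees g)) → HasCycle (adj g)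
hasBig⇒hasCycle g p with hasBig-sound (codegrees g) p
... | i , j , i<j , big with codegree->1 g i<j big
...   | w , w′ , w≢w′ , (iw , jw) , (iw′ , jw′) =
  square i w j w′ , square-cycle (adj-simple g) iw jw iw′ jw′ (Fin.<⇒≢ i<j) w≢w′

dot : Vec ℕ n → Vec Bool n → ℕ
dot []       []          = 0
dot (c ∷ cs) (true  ∷ r) = c + dot cs r
dot (c ∷ cs) (false ∷ r) = dot cs r

-- If C holds the codegrees of g, this is the number of 4-cycles of r ∷ g
-- through its new vertex.
cost : Tri ℕ n → Vec Bool n → ℕ
cost []      []          = 0
cost (c ∷ C) (true  ∷ r) = dot c r + cost C r
cost (c ∷ C) (false ∷ r) = cost C r

+-pos : ∀ x {y} → 0 < x + y → 0 < x ⊎ 0 < y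
+-pos zero    p = inj₂ p
+-pos (suc x) p = inj₁ (s≤s z≤n)

+-≤1 : ∀ {x y} → x ≤ 1 → y ≤ 1 → ¬ (0 < x × 0 < y) → x + y ≤ 1
+-≤1 {zero}  {y}     _         y≤1 _  = y≤1
+-≤1 {suc x} {zero}  x≤1       _   _  = subst (_≤ 1) (sym (ℕ.+-identityʳ (suc x))) x≤1
+-≤1 {suc x} {suc y} _         _   ¬p = ⊥-elim (¬p (s≤s z≤n , s≤s z≤n))

dot-pos : (c : Vec ℕ n) (r : Vec Bool n) → 0 < dot c r →
          ∃ λ j → lookup r j ≡ true × 0 < lookup c j
dot-pos []       []          ()
dot-pos (c ∷ cs) (false ∷ r) p = let (j , q) = dot-pos cs r p in suc j , q
dot-pos (c ∷ cs) (true ∷ r)  p with +-pos c p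
... | inj₁ q = zero , refl , q
... | inj₂ q = let (j , q′) = dot-pos cs r q in suc j , q′

dot-≤1 : (c : Vec ℕ n) (r : Vec Bool n) →
         (∀ j → lookup r j ≡ true → lookup c j ≤ 1) →
         (∀ j k → lookup r j ≡ true → 0 < lookup c j → lookup r k ≡ true → 0 < lookup c k → j ≡ k) →
         dot c r ≤ 1
dot-≤1 []       []          _    _    = z≤n
dot-≤1 (c ∷ cs) (false ∷ r) le uniq = dot-≤1 cs r (le ∘ suc)
  (λ j k a b a′ b′ → Fin.suc-injective (uniq (suc j) (suc k) a b a′ b′))
dot-≤1 (c ∷ cs) (true ∷ r)  le uniq =
  +-≤1 (le zero refl)
       (dot-≤1 cs r (le ∘ suc)
         (λ j k a b a′ b′ → Fin.suc-injective (uniq (suc j) (suc k) a b a′ b′)))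
       λ (p , q) → let (j , e , q′) = dot-pos cs r q in
         case uniq zero (suc j) refl p e q′ of λ ()

Selected : Tri ℕ n → Vec Bool n → Fin n → Fin n → Set
Selected C r i j = lookup r i ≡ true × lookup r j ≡ true × ∃ λ (i<j : i Fin.< j) → 0 < at C i j i<j

cost-pos : (C : Tri ℕ n) (r : Vec Bool n) → 0 < cost C r → ∃₂ (Selected C r)
cost-pos []      []          ()
cost-pos (c ∷ C) (false ∷ r) p =
  let (i , j , ri , rj , i<j , q) = cost-pos C r p in suc i , suc j , ri , rj , s≤s i<j , q
cost-pos (c ∷ C) (true ∷ r)  p with +-pos (dot c r) p
... | inj₁ q = let (j , e , q′) = dot-pos c r q in zero , suc j , refl , e , s≤s z≤n , q′
... | inj₂ q =
  let (i , j , ri , rj , i<j , q) = cost-pos C r q in suc i , suc j , ri , rj , s≤s i<j , q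

-- The cost adds the entries of all selected pairs: none exceeds 1, and at most one is positive.
cost-≤1 : (C : Tri ℕ n) (r : Vec Bool n) →
          (∀ i j → lookup r i ≡ true → lookup r j ≡ true → ∀ p → at C i j p ≤ 1) →
          (∀ {i j i′ j′} → Selected C r i j → Selected C r i′ j′ → i ≡ i′ × j ≡ j′) →
          cost C r ≤ 1
cost-≤1-tail : ∀ c (C : Tri ℕ n) b (r : Vec Bool n) →
          (∀ i j → lookup (b ∷ r) i ≡ true → lookup (b ∷ r) j ≡ true → ∀ p → at (c ∷ C) i j p ≤ 1) →
          (∀ {i j i′ j′} → Selected (c ∷ C) (b ∷ r) i j → Selected (c ∷ C) (b ∷ r) i′ j′ →
             i ≡ i′ × j ≡ j′) →
          cost C r ≤ 1
cost-≤1-tail c C b r le uniq = cost-≤1 C r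
  (λ i j ri rj p → le (suc i) (suc j) ri rj (s≤s p))
  (λ (ri , rj , p , q) (ri′ , rj′ , p′ , q′) →
     let (e , e′) = uniq (ri , rj , s≤s p , q) (ri′ , rj′ , s≤s p′ , q′)
     in  Fin.suc-injective e , Fin.suc-injective e′)

cost-≤1 []      []          _  _    = z≤n
cost-≤1 (c ∷ C) (false ∷ r) le uniq = cost-≤1-tail c C false r le uniq
cost-≤1 (c ∷ C) (true ∷ r)  le uniq =
  +-≤1 (dot-≤1 c r (λ j rj → le zero (suc j) refl rj (s≤s z≤n))
         λ j k rj pj rk pk → Fin.suc-injective
           (proj₂ (uniq {zero} {suc j} {zero} {suc k}
             (refl , rj , s≤s z≤n , pj) (refl , rk , s≤s z≤n , pk))))
       (cost-≤1-tail c C true r le uniq)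
       -- A positive entry in the first row and another below it would be two different selected
       -- pairs.
       λ (p , q) →
         let (j , rj , pj)               = dot-pos c r p
             (i′ , j′ , ri , rj′ , l , q′) = cost-pos C r q
         in  case proj₁ (uniq {zero} {suc j} {suc i′} {suc j′}
               (refl , rj , s≤s z≤n , pj) (ri , rj′ , s≤s l , q′)) of λ ()

module _ {r : Vec Bool n} {g : Tri Bool n} (one : OneCycle (adj (r ∷ g))) where

  private
    selected⇒spoke : ∀ {s t} → Selected (codegrees g) r s t → ∃ (Spoke r g s t)
    selected⇒spoke (rs , rt , s<t , p) =
      let (w , sw , tw) = codegree-pos g s<t p in w , spoke s<t rs rt sw tw

  -- A pair of codegree 2 would give two spokes that differ in `w`, and two pairs of positive
  -- codegree two spokes that differ in `s` or `t`; `spoke-unique` excludes both.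
  oneCycle⇒cost≤1 : cost (codegrees g) r ≤ 1
  oneCycle⇒cost≤1 = cost-≤1 (codegrees g) r small unique
    where
    small : ∀ s t → lookup r s ≡ true → lookup r t ≡ true → ∀ p → at (codegrees g) s t p ≤ 1
    small s t rs rt p with at (codegrees g) s t p ≤? 1
    ... | yes le = le
    ... | no  gt with codegree->1 g p (ℕ.≰⇒> gt)
    ...   | w , w′ , w≢w′ , (sw , tw) , (sw′ , tw′) = contradiction
      (proj₂ (proj₂ (spoke-unique one (spoke p rs rt sw tw) (spoke p rs rt sw′ tw′)))) w≢w′

    unique : ∀ {i j i′ j′} → Selected (codegrees g) r i j → Selected (codegrees g) r i′ j′ →
             i ≡ i′ × j ≡ j′
    unique p p′ =
      let (e , e′ , _) = spoke-unique one (proj₂ (selected⇒spoke p)) (proj₂ (selected⇒spoke p′))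
      in  e , e′

  -- A big codegree reveals a C₄ that avoids the new vertex, so no second one may pass through it.
  oneCycle⇒cost≡0 : T (hasBig (codegrees g)) → cost (codegrees g) r ≡ 0
  oneCycle⇒cost≡0 big with cost (codegrees g) r in eq
  ... | zero  = refl
  ... | suc _ =
    let (_ , _ , p) = cost-pos (codegrees g) r (subst (0 <_) (sym eq) (s≤s z≤n))
    in  contradiction (hasBig⇒hasCycle g big) (spoke⇒no-old-cycle one (proj₂ (selected⇒spoke p)))

-- Extension by a vertex, up to isomorphism

-- The row is stored with its `cost` and its number of neighbours, the two quantities by which the
-- search is pruned.
Candidate : ℕ → Set
Candidate n = Vec Bool n × ℕ × ℕ

-- The counters cost and trues of the enlarged row are passed as arguments, so
-- that evaluation shares them.
grow : (maxCost : ℕ) (k e : ℕ) → Vec ℕ n → Candidate n → List (Candidate (suc n))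
grow maxCost k e c (r , x , d) = (false ∷ r , x , d) ∷ enlarge (dot c r + x) (suc d)
  where
  enlarge : ℕ → ℕ → List (Candidate _)
  enlarge x′ d′ = if (x′ ≤ᵇ maxCost) ∧ (k * d′ ≤ᵇ e) then (true ∷ r , x′ , d′) ∷ [] else []

candidates : (maxCost : ℕ) (k e : ℕ) → Tri ℕ n → List (Candidate n)
candidates maxCost k e []      = ([] , 0 , 0) ∷ []
candidates maxCost k e (c ∷ C) = concatMap (grow maxCost k e c) (candidates maxCost k e C)

∈-if : ∀ {b} {x : A} → T b → x ∈ (if b then x ∷ [] else [])
∈-if {b = true} _ = here refl

cost-tail : ∀ (c : Vec ℕ n) (C : Tri ℕ n) b r → cost C r ≤ cost (c ∷ C) (b ∷ r)
cost-tail c C true  r = ℕ.m≤n+m (cost C r) (dot c r)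
cost-tail c C false r = ℕ.≤-refl

trues-tail : ∀ b (r : Vec Bool n) → trues r ≤ trues (b ∷ r)
trues-tail true  r = ℕ.n≤1+n (trues r)
trues-tail false r = ℕ.≤-refl

-- Prefixing an entry lowers neither counter, so a row within the bounds has all its tails within
-- them and is never cut off.
candidates-complete : ∀ maxCost k e (C : Tri ℕ n) r → cost C r ≤ maxCost → k * trues r ≤ e →
                      (r , cost C r , trues r) ∈ candidates maxCost k e C
candidates-complete maxCost k e []      []      _  _  = here refl
candidates-complete maxCost k e (c ∷ C) (b ∷ r) le ke =
  List∈.∈-concat⁺′ (grown b le ke)
    (List∈.∈-map⁺ (grow maxCost k e c)
      (candidates-complete maxCost k e C r
        (ℕ.≤-trans (cost-tail c C b r) le)
        (ℕ.≤-trans (ℕ.*-monoʳ-≤ k (trues-tail b r)) ke)))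
  where
  grown : ∀ b → cost (c ∷ C) (b ∷ r) ≤ maxCost → k * trues (b ∷ r) ≤ e →
          (b ∷ r , cost (c ∷ C) (b ∷ r) , trues (b ∷ r)) ∈ grow maxCost k e c (r , cost C r , trues r)
  grown false _ _ = here refl
  grown true le ke = there (∈-if (from Bool.T-∧ (ℕ.≤⇒≤ᵇ le , ℕ.≤⇒≤ᵇ ke)))

-- Isomorphic copies are merged by a heuristic normal form. Only the fact that
-- it permutes the vertices matters for soundness, and this is checked for each
-- proposed order.
weightedSquares : Vec ℕ n → Vec Bool n → ℕ
weightedSquares []       []          = 0
weightedSquares (w ∷ ws) (true  ∷ r) = w * w + weightedSquares ws r
weightedSquares (w ∷ ws) (false ∷ r) = weightedSquares ws r

-- One round of colour refinement, with colours hashed modulo 1009. The sum over the neighbours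
-- ignores their order, so isomorphic graphs receive corresponding weights.
refine : Vec (Vec Bool n) n → (Vec Bool n → ℕ → ℕ) → Vec ℕ n → Vec ℕ n
refine R extra ws =
  zipWith (λ r w → (w * 7 + weightedSquares ws r + extra r w) % 1009) R ws

-- Ties go to the smaller index; this is where isomorphic graphs can end in different normal forms.
argmax : Vec ℕ (suc n) → Fin (suc n) × ℕ
argmax (x ∷ [])         = zero , x
argmax (x ∷ xs@(_ ∷ _)) = better (argmax xs)
  where
  better : _ → _
  better (i , y) = if y ≤ᵇ x then (zero , x) else (suc i , y)

-- Only the first k choices refine the weights: this is cheaper, and three
-- refinements already leave few isomorphic copies.
pickAll : ∀ m (k : ℕ) → Vec (Vec Bool (suc n)) (suc n) → Vec Bool (suc n) → Vec ℕ (suc n) →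
          Vec (Fin (suc n)) m
pickAll zero    k R left ws = []
pickAll (suc m) k R left ws =
  -- The `suc` ranks a remaining vertex of weight 0 above those already picked.
  continue k (proj₁ (argmax (zipWith (λ l w → if l then suc w else 0) left ws)))
  where
  continue : ℕ → Fin _ → Vec (Fin _) (suc m)
  continue zero    v = v ∷ pickAll m 0 R (left Vec.[ v ]≔ false) ws
  continue (suc k) v = v ∷ pickAll m k R (left Vec.[ v ]≔ false)
    (refine R (λ r w → if lookup r v then w * 500 + 77 else 0) ws)

vertexOrder : Vec (Vec Bool (suc n)) (suc n) → Vec (Fin (suc n)) (suc n)
vertexOrder R =
  pickAll _ 3 R (Vec.replicate _ true) (refine R (λ _ _ → 0) (Vec.map (suc ∘ trues) R))

-- The inverse of `lookup` on an enumeration. The last position is also the default for absent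
-- vertices; `inverses?` rejects orders for which that matters.
position : Vec (Fin n) (suc m) → Fin n → Fin (suc m)
position (x ∷ [])         v = zero
position (x ∷ xs@(_ ∷ _)) v = if does (x Fin.≟ v) then zero else suc (position xs v)

toTri : Matrix n → Tri Bool n
toTri {zero}  M = []
toTri {suc n} M = tabulate (λ j → M zero (suc j)) ∷ toTri (restrict M suc)

adj-toTri : {M : Matrix n} → IsSimpleMatrix M → ∀ i j → adj (toTri M) i j ≡ M i j
adj-toTri s zero    zero    = sym (loopless s zero)
adj-toTri s zero    (suc j) = Vec.lookup∘tabulate _ j
adj-toTri s (suc i) zero    =
  trans (Vec.lookup∘tabulate _ i) (symmetric s zero (suc i))
adj-toTri {M = M} s (suc i) (suc j) = adj-toTri {M = restrict M suc} (restrict-simple s suc) i j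

Iso : Matrix n → Matrix n → Set
Iso {n} M N = ∃ λ (π : Permutation n n) → ∀ i j → M i j ≡ N (π ⟨$⟩ʳ i) (π ⟨$⟩ʳ j)

iso-trans : {L M N : Matrix n} → Iso L M → Iso M N → Iso L N
iso-trans (π , p) (ρ , q) = π ∘ₚ ρ , λ i j → trans (p i j) (q (π ⟨$⟩ʳ i) (π ⟨$⟩ʳ j))

Inverses : (o p : Fin n → Fin n) → Set
Inverses o p = (∀ i → o (p i) ≡ i) × (∀ i → p (o i) ≡ i)

inverses? : (o p : Fin n → Fin n) → Dec (Inverses o p)
inverses? o p = Fin.all? (λ i → o (p i) Fin.≟ i) ×-dec Fin.all? (λ i → p (o i) Fin.≟ i)

relabel : (g : Tri Bool (suc n)) → Vec (Fin (suc n)) (suc n) → Tri Bool (suc n)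
relabel g o with inverses? (lookup o) (position o)
... | yes _ = toTri (restrict (adj g) (lookup o))
... | no  _ = g

relabel-iso : (g : Tri Bool (suc n)) → ∀ o → Iso (adj (relabel g o)) (adj g)
relabel-iso g o with inverses? (lookup o) (position o)
... | yes (l , r) = permutation (lookup o) (position o) l r
                  , adj-toTri (restrict-simple (adj-simple g) (lookup o))
... | no  _       = Perm.id , λ _ _ → refl

normalise : Tri Bool (suc n) → Tri Bool (suc n)
normalise g = relabel g (vertexOrder (rows g))

normalise-iso : (g : Tri Bool (suc n)) → Iso (adj (normalise g)) (adj g)
normalise-iso g = relabel-iso g (vertexOrder (rows g))

infix 4 _≟ᵀ_

_≟ᵀ_ : (g h : Tri Bool n) → Dec (g ≡ h)
[]      ≟ᵀ []      = yes refl
(r ∷ g) ≟ᵀ (s ∷ h) = map′ (λ { (refl , refl) → refl }) (λ { refl → refl , refl })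
                          (Vec.≡-dec Bool._≟_ r s ×-dec g ≟ᵀ h)

module _ {n} (t : ℕ) (h : Tri Bool (suc n)) where

  attach : ℕ → Candidate (suc n) → List (Tri Bool (suc (suc n)))
  attach e (r , _ , d) = if t ≤ᵇ d + e then normalise (r ∷ h) ∷ [] else []

  extendWith : ℕ → Tri ℕ (suc n) → List (Tri Bool (suc (suc n)))
  extendWith e C =
    -- A C₄ in `h` uses up the only one allowed. With `d` new edges, `n * d ≤ e + e` is equivalent
    -- to `(2 + n) * d ≤ 2 * (e + d)`: the new vertex has at most average degree.
    concatMap (attach e) (candidates (if hasBig C then 0 else 1) n (e + e) C)

  extensions : List (Tri Bool (suc (suc n)))
  extensions = extendWith (#edges h) (codegrees h)

  extensions-complete : ∀ r → OneCycle (adj (r ∷ h)) → n * trues r ≤ #edges h + #edges h →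
                        t ≤ #edges (r ∷ h) → normalise (r ∷ h) ∈ extensions
  extensions-complete r one nd t≤ =
    List∈.∈-concat⁺′ attached (List∈.∈-map⁺ (attach (#edges h))
      (candidates-complete _ n _ C r affordable nd))
    where
    C : Tri ℕ (suc n)
    C = codegrees h

    affordable : cost C r ≤ (if hasBig C then 0 else 1)
    affordable with hasBig C in eq
    ... | true  = ℕ.≤-reflexive (oneCycle⇒cost≡0 one (subst T (sym eq) tt))
    ... | false = oneCycle⇒cost≤1 one

    attached : normalise (r ∷ h) ∈ attach (#edges h) (r , cost C r , trues r)
    attached = ∈-if (ℕ.≤⇒≤ᵇ t≤)

step : ℕ → List (Tri Bool (suc n)) → List (Tri Bool (suc (suc n)))
step t L = List.deduplicate _≟ᵀ_ (concatMap (extensions t) L)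

-- Completeness of the lists

Complete : ℕ → List (Tri Bool n) → Set
Complete {n} t L = {M : Matrix n} → IsSimpleMatrix M → OneCycle M → t ≤ edges M →
                   ∃ λ g → g ∈ L × Iso (adj g) M

permutation-injective : (π : Permutation m n) → Injective _≡_ _≡_ (π ⟨$⟩ʳ_)
permutation-injective π eq =
  trans (sym (inverseˡ π)) (trans (cong (π ⟨$⟩ˡ_) eq) (inverseˡ π))

-- A vertex of degree d ≤ 2(e + d)/(n + 2) can be deleted from a graph with
-- n + 2 vertices and e + d ≥ t′ edges, and t ≤ e follows from the inequality
-- between the two thresholds.
threshold-step : ∀ n t t′ d e → (2 + n) * t < 2 + n * suc t′ →
                 n * d ≤ e + e → t′ ≤ d + e → t ≤ e
threshold-step n t t′ d e small nd t′≤ with t ≤? e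
... | yes t≤e = t≤e
... | no  t≰e = contradiction small (ℕ.≤⇒≯ (begin
  2 + n * suc t′                    ≤⟨ ℕ.+-monoʳ-≤ 2 (ℕ.*-monoʳ-≤ n (s≤s t′≤)) ⟩
  2 + n * suc (d + e)               ≡⟨ rearrange₁ n d e ⟩
  n * d + (2 + (n + n * e))         ≤⟨ ℕ.+-monoˡ-≤ (2 + (n + n * e)) nd ⟩
  (e + e) + (2 + (n + n * e))       ≡⟨ rearrange₂ n e ⟩
  (2 + n) * suc e                   ≤⟨ ℕ.*-monoʳ-≤ (2 + n) (ℕ.≰⇒> t≰e) ⟩
  (2 + n) * t                       ∎))
  where
  open ℕ.≤-Reasoning

  rearrange₁ : ∀ n d e → 2 + n * suc (d + e) ≡ n * d + (2 + (n + n * e))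
  rearrange₁ = solve-∀

  rearrange₂ : ∀ n e → (e + e) + (2 + (n + n * e)) ≡ (2 + n) * suc e
  rearrange₂ = solve-∀

-- Every graph is, up to isomorphism, an extension by a vertex of degree at
-- most average.
step-complete : ∀ t t′ (L : List (Tri Bool (suc n))) → (2 + n) * t < 2 + n * suc t′ →
                Complete t L → Complete t′ (step t′ L)
step-complete {n} t t′ L small complete {M} s one t′≤
  with ∃-≤-average (degree M)
... | v , average = finish (complete simple′ one′ enough)
  where
  -- This moves `v` to index 0, where restriction along `suc` deletes it.
  τ : Permutation (2 + n) (2 + n)
  τ = Perm.transpose zero v

  M₁ : Matrix (2 + n)
  M₁ = restrict M (τ ⟨$⟩ʳ_)

  M′ : Matrix (suc n)
  M′ = restrict M₁ suc

  d : ℕ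
  d = sum (λ j → 𝟙 (M₁ zero (suc j)))

  s₁ : IsSimpleMatrix M₁
  s₁ = restrict-simple s (τ ⟨$⟩ʳ_)

  simple′ : IsSimpleMatrix M′
  simple′ = restrict-simple s₁ suc

  one′ : OneCycle M′
  one′ = oneCycle-∘ {M = M} (λ i → τ ⟨$⟩ʳ suc i)
    (Fin.suc-injective ∘ permutation-injective τ) (λ _ _ → refl) one

  degree≡ : degree M v ≡ d
  degree≡ = trans (sym (degree-permute M τ zero))
                  (cong (λ b → 𝟙 b + d) (loopless s₁ zero))

  edges≡ : edges M ≡ d + edges M′
  edges≡ = sym (edges-permute s τ)

  low : n * d ≤ edges M′ + edges M′
  -- The edges at `v` contribute `d + d` to the degree sum; cancelling them expresses the average
  -- bound through the edges that remain.
  low = ℕ.+-cancelˡ-≤ (d + d) _ _ (begin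
    (d + d) + n * d                     ≡⟨ ℕ.+-assoc d d (n * d) ⟩
    (2 + n) * d                         ≡⟨ cong ((2 + n) *_) degree≡ ⟨
    (2 + n) * degree M v                ≤⟨ average ⟩
    degreeSum M                         ≡⟨ handshake s ⟩
    edges M + edges M                   ≡⟨ cong₂ _+_ edges≡ edges≡ ⟩
    (d + edges M′) + (d + edges M′)     ≡⟨ rearrange d (edges M′) ⟩
    (d + d) + (edges M′ + edges M′)     ∎)
    where
    open ℕ.≤-Reasoning

    rearrange : ∀ d e → (d + e) + (d + e) ≡ (d + d) + (e + e)
    rearrange = solve-∀

  enough : t ≤ edges M′
  enough = threshold-step n t t′ d (edges M′) small low (subst (t′ ≤_) edges≡ t′≤)

  finish : (∃ λ h → h ∈ L × Iso (adj h) M′) → ∃ λ g → g ∈ step t′ L × Iso (adj g) M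
  finish (h , h∈L , π , eq) =
      normalise (r ∷ h)
    , List∈.∈-deduplicate⁺ _≟ᵀ_
        (List∈.∈-concat⁺′ (extensions-complete t′ h r one-h low-h enough-h)
                          (List∈.∈-map⁺ (extensions t′) h∈L))
    , iso-trans {M = adj (r ∷ h)} {N = M} (normalise-iso (r ∷ h)) (σ , eqσ)
    where
    -- The neighbours of `v`, read in the vertex order of the representative `h`.
    row : Fin (suc n) → Bool
    row j = M₁ zero (suc (π ⟨$⟩ʳ j))

    r : Vec Bool (suc n)
    r = tabulate row

    σ : Permutation (2 + n) (2 + n)
    σ = lift₀ π ∘ₚ τ

    eq₁ : ∀ i j → adj (r ∷ h) i j ≡ M₁ (lift₀ π ⟨$⟩ʳ i) (lift₀ π ⟨$⟩ʳ j)
    eq₁ zero    zero    = sym (loopless s₁ zero)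
    eq₁ zero    (suc j) = Vec.lookup∘tabulate row j
    eq₁ (suc i) zero    = trans (Vec.lookup∘tabulate row i) (symmetric s₁ zero (suc (π ⟨$⟩ʳ i)))
    eq₁ (suc i) (suc j) = eq i j

    eqσ : ∀ i j → adj (r ∷ h) i j ≡ M (σ ⟨$⟩ʳ i) (σ ⟨$⟩ʳ j)
    eqσ = eq₁

    one-h : OneCycle (adj (r ∷ h))
    one-h = oneCycle-∘ {M = M} (σ ⟨$⟩ʳ_) (permutation-injective σ) eqσ one

    trues-r : trues r ≡ d
    trues-r = begin
      trues r                                     ≡⟨ trues≡sum r ⟩
      sum (λ j → 𝟙 (lookup r j))                  ≡⟨ sum-cong-≗ (λ j → cong 𝟙 (Vec.lookup∘tabulate row j)) ⟩
      sum (λ j → 𝟙 (row j))    ≡⟨ ∑-permute (λ j → 𝟙 (M₁ zero (suc j))) π ⟨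
      d                                           ∎
      where open ≡-Reasoning

    #edges-h : #edges h ≡ edges M′
    #edges-h = trans (#edges≡edges h) (trans (edges-cong eq) (edges-permute simple′ π))

    low-h : n * trues r ≤ #edges h + #edges h
    low-h = subst₂ (λ x y → n * x ≤ y + y) (sym trues-r) (sym #edges-h) low

    enough-h : t′ ≤ trues r + #edges h
    enough-h = subst₂ (λ x y → t′ ≤ x + y) (sym trues-r) (sym #edges-h) (subst (t′ ≤_) edges≡ t′≤)

-- Classification

nth : ℕ → List ℕ → ℕ
nth i       []       = 0
nth zero    (x ∷ xs) = x
nth (suc i) (x ∷ xs) = nth i xs

-- Found by experiment: small enough for threshold-step, and large enough to
-- keep the lists of graphs with threshold n edges short.
threshold : ℕ → ℕ
threshold n = nth n (0 ∷ 0 ∷ 0 ∷ 1 ∷ 3 ∷ 5 ∷ 7 ∷ 9 ∷ 11 ∷ 13 ∷ 16 ∷ 19 ∷ 22 ∷ 25 ∷ [])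

-- The expected values of ex(n,C₄); `ex≡turán` confirms them wherever a `Witness` is given.
turán : ℕ → ℕ
turán n = nth n (0 ∷ 0 ∷ 1 ∷ 3 ∷ 4 ∷ 6 ∷ 7 ∷ 9 ∷ 11 ∷ 13 ∷ 16 ∷ 18 ∷ 21 ∷ 24 ∷ [])

acceptable : Tri Bool n → Bool
acceptable {n} g = (#edges g ≤ᵇ turán n) ∨ ((n <ᵇ 12) ∧ hasBig (codegrees g))

-- One statement serves both purposes: `HasCycle M` refutes C₄-free graphs with more than `turán n`
-- edges, and for n ≥ 12 the factor `n < 12` also refutes those with a single C₄.
Acceptable : ℕ → Set
Acceptable n = {M : Matrix n} → IsSimpleMatrix M → OneCycle M →
               threshold n ≤ edges M → turán n < edges M → n < 12 × HasCycle M

acceptable-sound : (L : List (Tri Bool n)) → Complete (threshold n) L →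
                   T (Bool.all acceptable L) → Acceptable n
acceptable-sound {n} L complete ok {M} s one t≤ turán<
  with complete s one t≤
... | g , g∈L , π , eq =
  conclude (to Bool.T-∨ (All.lookup (All.all⁺ acceptable L ok) g∈L))
  where
  #edges≡ : #edges g ≡ edges M
  #edges≡ = trans (#edges≡edges g) (trans (edges-cong eq) (edges-permute s π))

  conclude : T (#edges g ≤ᵇ turán n) ⊎ T ((n <ᵇ 12) ∧ hasBig (codegrees g)) →
             n < 12 × HasCycle M
  conclude (inj₁ few) =
    contradiction turán< (ℕ.≤⇒≯ (subst (_≤ turán n) #edges≡ (ℕ.≤ᵇ⇒≤ _ _ few)))
  conclude (inj₂ both) =
    let (n<12 , big) = to (Bool.T-∧ {n <ᵇ 12}) both
        (f , fc)     = hasBig⇒hasCycle g big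
    in  ℕ.<ᵇ⇒< n 12 n<12 , (π ⟨$⟩ʳ_) ∘ f
      , cycle-∘ {M = M} (π ⟨$⟩ʳ_) (permutation-injective π) eq f fc

AcceptableFrom : ℕ → ℕ → Set
AcceptableFrom zero    n = Acceptable n
AcceptableFrom (suc m) n = Acceptable n × AcceptableFrom m (suc n)

verify : ℕ → List (Tri Bool (suc n)) → Bool
verify         zero    L = Bool.all acceptable L
verify {n = n} (suc m) L =
  Bool.all acceptable L
    ∧ ((2 + n) * threshold (1 + n) <ᵇ 2 + n * suc (threshold (2 + n)))
    ∧ verify m (step (threshold (2 + n)) L)

verify-sound : ∀ m (L : List (Tri Bool (suc n))) → Complete (threshold (suc n)) L →
               verify m L ≡ true → AcceptableFrom m (suc n)
verify-sound         zero    L complete ok = acceptable-sound L complete (from Bool.T-≡ ok)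
verify-sound {n = n} (suc m) L complete ok =
  let (now , ok′)     = ∧-true ok
      (small , later) = ∧-true ok′
  in  acceptable-sound L complete (from Bool.T-≡ now)
    , verify-sound m _
        (step-complete (threshold (suc n)) (threshold (2 + n)) L
          (ℕ.<ᵇ⇒< _ _ (from Bool.T-≡ small)) complete)
        later

complete-1 : Complete 0 (([] ∷ []) ∷ [])
complete-1 s one _ = [] ∷ [] , here refl , Perm.id , λ { zero zero → sym (loopless s zero) }

-- Here type checking runs the whole classification, from 1 to 13 vertices.
verified : verify 12 (([] ∷ []) ∷ []) ≡ true
verified = refl

opaque
  acceptable-from-1 : AcceptableFrom 12 1
  acceptable-from-1 = verify-sound 12 (([] ∷ []) ∷ []) complete-1 verified

-- Sizes and copies

matrix : Graph n → Matrix n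
matrix G i j = lookup (lookup (Graph.nbhd G) i) j

≡-of-⇔ : ∀ {b c} → (b ≡ true → c ≡ true) → (c ≡ true → b ≡ true) → b ≡ c
≡-of-⇔ {true}  {c}     f _ = sym (f refl)
≡-of-⇔ {false} {true}  _ g = g refl
≡-of-⇔ {false} {false} _ _ = refl

flip-lookup : (N : Vec (Subset n) n) →
              (∀ i j → lookup N i Vec.[ j ]= true → lookup N j Vec.[ i ]= true) →
              ∀ i j → lookup (lookup N i) j ≡ true → lookup (lookup N j) i ≡ true
flip-lookup N sy i j e = Vec.[]=⇒lookup (sy i j (Vec.lookup⇒[]= j (lookup N i) e))

-- The laws of a `Graph` are irrelevant, but equality of booleans is decidable, so proofs of it can
-- be recomputed.
matrix-simple : (G : Graph n) → IsSimpleMatrix (matrix G)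
matrix-simple (mkGraph N sy lo) = record
  { symmetric = λ i j → recompute (_ Bool.≟ _)
      (≡-of-⇔ (flip-lookup N sy i j) (flip-lookup N sy j i))
  ; loopless  = λ i → recompute (_ Bool.≟ _)
      (Bool.¬-not (λ e → lo i (Vec.lookup⇒[]= i (lookup N i) e)))
  }

adj?≡matrix : (G : Graph n) → ∀ i j → does (adj? G i j) ≡ matrix G i j
adj?≡matrix G i j with adj? G i j
... | yes a = sym (Vec.[]=⇒lookup a)
... | no ¬a = sym (Bool.¬-not (λ e → ¬a (Vec.lookup⇒[]= j _ e)))

length-filter-tabulate : {P : A → Set} (P? : ∀ x → Dec (P x)) (f : Fin n → A) →
  length (filter P? (List.tabulate f)) ≡ sum (λ i → 𝟙 (does (P? (f i))))
length-filter-tabulate {n = zero}  P? f = refl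
length-filter-tabulate {n = suc n} P? f with does (P? (f zero))
... | true  = cong suc (length-filter-tabulate P? (f ∘ suc))
... | false = length-filter-tabulate P? (f ∘ suc)

length-filter-product : {P : A × B → Set} (P? : ∀ x → Dec (P x)) (f : Fin m → A) (g : Fin n → B) →
  length (filter P? (cartesianProduct (List.tabulate f) (List.tabulate g)))
    ≡ sum (λ i → sum (λ j → 𝟙 (does (P? (f i , g j)))))
length-filter-product {m = zero}  P? f g = refl
length-filter-product {m = suc m} P? f g = begin
  length (filter P? (row List.++ rest))
    ≡⟨ cong length (List.filter-++ P? row rest) ⟩
  length (filter P? row List.++ filter P? rest)
    ≡⟨ List.length-++ (filter P? row) ⟩
  length (filter P? row) + length (filter P? rest)
    ≡⟨ cong₂ _+_
         (trans (cong (length ∘ filter P?) (List.map-tabulate g (f zero ,_)))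
                (length-filter-tabulate P? (λ j → f zero , g j)))
         (length-filter-product P? (f ∘ suc) g) ⟩
  _ ∎
  where
  open ≡-Reasoning
  row rest : List _
  row  = List.map (f zero ,_) (List.tabulate g)
  rest = cartesianProduct (List.tabulate (f ∘ suc)) (List.tabulate g)

-- The comparison evaluates to true on the rest of row 0 and to false on column 0, so peeling off
-- index 0 matches the recursion of `edges`.
edges≡sum : (M : Matrix n) → sum (λ i → sum (λ j → 𝟙 (does (i Fin.<? j) ∧ M i j))) ≡ edges M
edges≡sum {zero}  M = refl
edges≡sum {suc n} M = cong (sum (λ j → 𝟙 (M zero (suc j))) +_) (edges≡sum (restrict M suc))

size≡edges : (G : Graph n) → size G ≡ edges (matrix G)
size≡edges {n} G = begin
  size G
    ≡⟨ length-filter-product (edge? G) (λ i → i) (λ j → j) ⟩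
  sum (λ i → sum (λ j → 𝟙 (does (i Fin.<? j) ∧ does (adj? G i j))))
    ≡⟨ sum-cong-≗ (λ i → sum-cong-≗ λ j → cong (λ b → 𝟙 (does (i Fin.<? j) ∧ b)) (adj?≡matrix G i j)) ⟩
  sum (λ i → sum (λ j → 𝟙 (does (i Fin.<? j) ∧ matrix G i j)))
    ≡⟨ edges≡sum (matrix G) ⟩
  edges (matrix G) ∎
  where open ≡-Reasoning

-- Copies of C₄ and parametrised 4-cycles

Contents : ℕ → Set
Contents n = Subset n × Vec (Subset n) n

contents : Part n → Contents n
contents (V , E) = V , Graph.nbhd E

-- As the laws are irrelevant, the boolean data determine a part. Copies are therefore compared
-- through data whose equality is decided by evaluation.
contents-injective : {P Q : Part n} → contents P ≡ contents Q → P ≡ Q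
contents-injective {P = V , mkGraph N _ _} {W , mkGraph .N _ _} refl = refl

onCycle? : (f : Fin 4 → Fin n) → ∀ v → Dec (∃ λ i → f i ≡ v)
onCycle? f v = Fin.any? λ i → f i Fin.≟ v

cycleEdge? : (f : Fin 4 → Fin n) → ∀ x y → Dec (CycleEdge f x y)
cycleEdge? f x y = Fin.any? λ i → Fin.any? λ j →
  adj? C₄ i j ×-dec (f i Fin.≟ x) ×-dec (f j Fin.≟ y)

cycleContents : (Fin 4 → Fin n) → Contents n
cycleContents f =
  tabulate (λ v → does (onCycle? f v)) , tabulate (λ x → tabulate λ y → does (cycleEdge? f x y))

∈-tabulate-does : {P : Fin n → Set} (P? : ∀ i → Dec (P i)) → ∀ i →
                  (tabulate (does ∘ P?) Vec.[ i ]= true) ⇔ P i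
∈-tabulate-does {P = P} P? i = mk⇔
  (λ p → holds (trans (sym (Vec.lookup∘tabulate (does ∘ P?) i)) (Vec.[]=⇒lookup p)))
  (λ p → Vec.lookup⇒[]= i _ (trans (Vec.lookup∘tabulate (does ∘ P?) i) (dec-true (P? i) p)))
  where
  holds : does (P? i) ≡ true → P i
  holds e with P? i
  ... | yes p = p

∈-cycleNbhd : (f : Fin 4 → Fin n) → ∀ x y →
             (lookup (proj₂ (cycleContents f)) x Vec.[ y ]= true) ⇔ CycleEdge f x y
∈-cycleNbhd f x y = subst (λ r → (r Vec.[ y ]= true) ⇔ CycleEdge f x y)
  (sym (Vec.lookup∘tabulate (λ x → tabulate λ y → does (cycleEdge? f x y)) x))
  (∈-tabulate-does (cycleEdge? f x) y)

-- Injectivity excludes loops: equal images come from equal corners, and C₄ has no loop. Being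
-- irrelevant, it leaves the part dependent on `f` alone.
cyclePart : (f : Fin 4 → Fin n) → .(Injective _≡_ _≡_ f) → Part n
cyclePart f inj = proj₁ (cycleContents f) , mkGraph (proj₂ (cycleContents f))
  (λ x y p → let (i , j , a , e , e′) = to (∈-cycleNbhd f x y) p
             in  from (∈-cycleNbhd f y x) (j , i , C₄-sym i j a , e′ , e))
  (λ x p → let (i , j , a , e , e′) = to (∈-cycleNbhd f x x) p
           in  C₄-irreflexive i (subst (Adj C₄ i) (inj (trans e′ (sym e))) a))
  where
  C₄-sym : ∀ i j → Adj C₄ i j → Adj C₄ j i
  C₄-sym i j a = Vec.lookup⇒[]= i _
    (trans (symmetric (matrix-simple C₄) j i) (Vec.[]=⇒lookup a))

  C₄-irreflexive : ∀ i → ¬ Adj C₄ i i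
  C₄-irreflexive i a =
    case trans (sym (Vec.[]=⇒lookup a)) (loopless (matrix-simple C₄) i) of λ ()

cyclePart-copy : (G : Graph n) (f : Fin 4 → Fin n) (c : IsCycle (matrix G) f) →
                 IsCopy C₄ G (cyclePart f (proj₁ c))
cyclePart-copy G f (inj , edge) =
    (λ x y p → let (i , j , a , e , e′) = to (∈-cycleNbhd f x y) p in
        subst₂ (Adj G) e e′ (Vec.lookup⇒[]= (f j) _ (edge i j a))
      , from (∈-tabulate-does (onCycle? f) x) (i , e)
      , from (∈-tabulate-does (onCycle? f) y) (j , e′))
  , f , inj , ∈-tabulate-does (onCycle? f)
  , λ i j → mk⇔
      (λ a → from (∈-cycleNbhd f (f i) (f j)) (i , j , a , refl , refl))
      (λ p → let (i′ , j′ , a , e , e′) = to (∈-cycleNbhd f (f i) (f j)) p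
             in  subst₂ (Adj C₄) (inj e) (inj e′) a)

-- The corners are returned as a vector, because functions that agree pointwise need not be equal;
-- `η` compares its `lookup` with the given isomorphism.
copy⇒cycle : (G : Graph n) {P : Part n} → IsCopy C₄ G P →
             ∃ λ (v : Vec (Fin n) 4) →
               IsCycle (matrix G) (lookup v) × contents P ≡ cycleContents (lookup v)
copy⇒cycle {n} G {V , E} (sub , f , inj , img , iso) = f 0F ∷ f 1F ∷ f 2F ∷ f 3F ∷ [] , (inj-g , edge) , cong₂ _,_
  (Subset.⊆-antisym
    (λ {v} p → from (∈-tabulate-does (onCycle? g) v)
                 (let (i , e) = to (img v) p in i , trans (η i) e))
    (λ {v} p → let (i , e) = to (∈-tabulate-does (onCycle? g) v) p
               in  from (img v) (i , trans (sym (η i)) e)))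
  (trans (sym (Vec.tabulate∘lookup (Graph.nbhd E)))
  (trans (Vec.tabulate-cong λ x → Subset.⊆-antisym (λ {y} → forth x y) (λ {y} → back x y))
         (Vec.tabulate∘lookup (proj₂ (cycleContents g)))))
  where
  g : Fin 4 → Fin n
  g = square (f 0F) (f 1F) (f 2F) (f 3F)

  η : ∀ i → g i ≡ f i
  η 0F = refl
  η 1F = refl
  η 2F = refl
  η 3F = refl

  inj-g : Injective _≡_ _≡_ g
  inj-g {i} {j} e = inj (trans (sym (η i)) (trans e (η j)))

  edge : ∀ i j → Adj C₄ i j → matrix G (g i) (g j) ≡ true
  edge i j a = subst₂ (λ x y → matrix G x y ≡ true) (sym (η i)) (sym (η j))
    (Vec.[]=⇒lookup (proj₁ (sub (f i) (f j) (to (iso i j) a))))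

  forth : ∀ x y → Adj E x y → lookup (proj₂ (cycleContents g)) x Vec.[ y ]= true
  forth x y p with sub x y p
  ... | _ , x∈ , y∈ with to (img x) x∈ | to (img y) y∈
  ...   | i , refl | j , refl = from (∈-cycleNbhd g (f i) (f j)) (i , j , from (iso i j) p , η i , η j)

  back : ∀ x y → lookup (proj₂ (cycleContents g)) x Vec.[ y ]= true → Adj E x y
  back x y p = let (i , j , a , e , e′) = to (∈-cycleNbhd g x y) p in
    subst₂ (Adj E) (trans (sym (η i)) e) (trans (sym (η j)) e′) (to (iso i j) a)

length≤1⇒≡ : {xs : List A} → length xs ≤ 1 → ∀ {x y} → x ∈ xs → y ∈ xs → x ≡ y
length≤1⇒≡ {xs = _ ∷ []} _        (here refl) (here refl) = refl
length≤1⇒≡ {xs = _ ∷ _ ∷ _} (s≤s ())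

copies≤1⇒≡ : (H : Graph m) (G : Graph n) → #copies H G ≤ 1 → ∀ {P Q} → IsCopy H G P → IsCopy H G Q → P ≡ Q
copies≤1⇒≡ {n = n} H G le p q = length≤1⇒≡ (subst (_≤ 1) count le) (member _ p) (member _ q)
  where
  member : ∀ P → IsCopy H G P → P ∈ filter (isCopy? H G) (parts n)
  member P = List∈.∈-filter⁺ (isCopy? H G) (∈-parts P)

  -- `#copies` is opaque here; its specification, applied to the very list that defines it, recovers
  -- the definition.
  count : #copies H G ≡ length (filter (isCopy? H G) (parts n))
  count = #copies-spec H G (Unique.filter⁺ (isCopy? H G) (parts-unique n))
    λ P → mk⇔ (λ P∈ → proj₂ (List∈.∈-filter⁻ (isCopy? H G) {xs = parts n} P∈)) (member P)

-- Both 4-cycles span copies of C₄; these coincide as parts, hence so do their edges.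
copies≤1⇒oneCycle : (G : Graph n) → #copies C₄ G ≤ 1 → OneCycle (matrix G)
copies≤1⇒oneCycle G le f g fc gc x y e =
  to (∈-cycleNbhd g x y)
    (subst (λ c → lookup (proj₂ c) x Vec.[ y ]= true)
      (cong contents {x = cyclePart f (proj₁ fc)} {y = cyclePart g (proj₁ gc)}
        (copies≤1⇒≡ C₄ G le (cyclePart-copy G f fc) (cyclePart-copy G g gc)))
      (from (∈-cycleNbhd f x y) e))

-- Extremal graphs

graph : Tri Bool n → Graph n
graph g = mkGraph (rows g)
  (λ i j p → Vec.lookup⇒[]= i (lookup (rows g) j)
    (trans (symmetric simple j i) (Vec.[]=⇒lookup p)))
  (λ i p → case trans (sym (Vec.[]=⇒lookup p)) (loopless simple i) of λ ())
  where
  simple : IsSimpleMatrix (λ i j → lookup (lookup (rows g) i) j)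
  simple = record
    { symmetric = λ i j → trans (lookup-rows g i j)
        (trans (symmetric (adj-simple g) i j) (sym (lookup-rows g j i)))
    ; loopless  = λ i → trans (lookup-rows g i i) (loopless (adj-simple g) i)
    }

size-graph : (g : Tri Bool n) → size (graph g) ≡ #edges g
size-graph g = trans (size≡edges (graph g))
                     (trans (edges-cong (lookup-rows g)) (sym (#edges≡edges g)))

_≟ᶜ_ : (P Q : Contents n) → Dec (P ≡ Q)
_≟ᶜ_ = Product.≡-dec (Vec.≡-dec Bool._≟_) (Vec.≡-dec (Vec.≡-dec Bool._≟_))

contentsOf : List (Vec (Fin n) 4) → List (Contents n)
contentsOf = List.map (cycleContents ∘ lookup)

-- The order of the hypotheses lets exhaustive? discard most choices early.
Exhaustive : Tri Bool n → List (Vec (Fin n) 4) → Set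
Exhaustive g vs =
  ∀ a b → adj g a b ≡ true → ∀ c → adj g c b ≡ true → a ≢ c →
  ∀ d → adj g a d ≡ true → adj g c d ≡ true → b ≢ d →
  cycleContents (square a b c d) ∈ contentsOf vs

exhaustive? : (g : Tri Bool n) → ∀ vs → Dec (Exhaustive g vs)
exhaustive? g vs =
  Fin.all? λ a → Fin.all? λ b → (adj g a b Bool.≟ true) →-dec
  Fin.all? λ c → (adj g c b Bool.≟ true) →-dec ¬? (a Fin.≟ c) →-dec
  Fin.all? λ d → (adj g a d Bool.≟ true) →-dec (adj g c d Bool.≟ true) →-dec
    ¬? (b Fin.≟ d) →-dec
  Any.any? (λ P → cycleContents (square a b c d) ≟ᶜ P) (contentsOf vs)

isCycle? : (g : Tri Bool n) (f : Fin 4 → Fin n) → Dec (IsCycle (adj g) f)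
isCycle? g f =
  map′ (λ inj {i} {j} → inj i j) (λ inj i j → inj {i} {j})
       (Fin.all? λ i → Fin.all? λ j → (f i Fin.≟ f j) →-dec (i Fin.≟ j))
  ×-dec (Fin.all? λ i → Fin.all? λ j → adj? C₄ i j →-dec (adj g (f i) (f j) Bool.≟ true))

Cycles : Tri Bool n → List (Vec (Fin n) 4) → Set
Cycles g vs = All (λ v → IsCycle (adj g) (lookup v)) vs × Unique (contentsOf vs) × Exhaustive g vs

cycles? : (g : Tri Bool n) → ∀ vs → Dec (Cycles g vs)
cycles? g vs = All.all? (λ v → isCycle? g (lookup v)) vs
  ×-dec UniqueDec.unique? _≟ᶜ_ (contentsOf vs) ×-dec exhaustive? g vs

copy-∈-contents : (g : Tri Bool n) → ∀ {vs} → Exhaustive g vs →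
                  ∀ P → IsCopy C₄ (graph g) P → contents P ∈ contentsOf vs
copy-∈-contents {n} g {vs} ex P copy = conclude (copy⇒cycle (graph g) {P} copy)
  where
  conclude : (∃ λ (v : Vec (Fin n) 4) → IsCycle (matrix (graph g)) (lookup v) ×
                                        contents P ≡ cycleContents (lookup v)) →
             contents P ∈ contentsOf vs
  conclude (a ∷ b ∷ c ∷ d ∷ [] , (inj , edge) , eq) = subst (_∈ contentsOf vs) (sym eq)
    (ex a b (adj! 0F 1F (Vec.there Vec.here))
        c (adj! 2F 1F (Vec.there Vec.here)) (λ e → case inj {0F} {2F} e of λ ())
        d (adj! 0F 3F (Vec.there (Vec.there (Vec.there Vec.here))))
          (adj! 2F 3F (Vec.there (Vec.there (Vec.there Vec.here))))
          (λ e → case inj {1F} {3F} e of λ ()))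
    where
    v : Vec (Fin n) 4
    v = a ∷ b ∷ c ∷ d ∷ []

    adj! : ∀ i j → Adj C₄ i j → adj g (lookup v i) (lookup v j) ≡ true
    adj! i j p = trans (sym (lookup-rows g (lookup v i) (lookup v j))) (edge i j p)

exhaustive⇒free : (g : Tri Bool n) → Exhaustive g [] → Free C₄ (graph g)
exhaustive⇒free g ex (P , copy) = case copy-∈-contents g ex P copy of λ ()

module _ (g : Tri Bool n) where

  partsOf : ∀ vs → All (λ v → IsCycle (adj g) (lookup v)) vs → List (Part n)
  partsOf []       []       = []
  partsOf (v ∷ vs) (c ∷ cs) = cyclePart (lookup v) (proj₁ c) ∷ partsOf vs cs

  contents-partsOf : ∀ vs cs → List.map contents (partsOf vs cs) ≡ contentsOf vs
  contents-partsOf []       []       = refl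
  contents-partsOf (v ∷ vs) (c ∷ cs) = cong (_ ∷_) (contents-partsOf vs cs)

  partsOf-copies : ∀ vs cs → ∀ {P} → P ∈ partsOf vs cs → IsCopy C₄ (graph g) P
  partsOf-copies (v ∷ vs) (c ∷ cs) (here refl) = cyclePart-copy (graph g) (lookup v)
    (proj₁ c , λ i j a → trans (lookup-rows g _ _) (proj₂ c i j a))
  partsOf-copies (v ∷ vs) (c ∷ cs) (there P∈)  = partsOf-copies vs cs P∈

  -- Distinct contents make the listed parts distinct, and exhaustiveness puts the contents of every
  -- copy among theirs, so the list meets `#copies-spec`.
  #copies≡length : ∀ {vs} → Cycles g vs → #copies C₄ (graph g) ≡ length vs
  #copies≡length {vs} (cs , unique , exhaustive) = trans
    (#copies-spec C₄ (graph g) (Unique.map⁻ (subst Unique (sym (contents-partsOf vs cs)) unique))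
      λ P → mk⇔ (partsOf-copies vs cs) (member P))
    (begin
      length (partsOf vs cs)                        ≡⟨ List.length-map contents (partsOf vs cs) ⟨
      length (List.map contents (partsOf vs cs))    ≡⟨ cong length (contents-partsOf vs cs) ⟩
      length (contentsOf vs)                        ≡⟨ List.length-map _ vs ⟩
      length vs                                     ∎)
    where
    open ≡-Reasoning

    member : ∀ P → IsCopy C₄ (graph g) P → P ∈ partsOf vs cs
    member P copy = conclude (List∈.∈-map⁻ contents
      (subst (contents P ∈_) (sym (contents-partsOf vs cs)) (copy-∈-contents g exhaustive P copy)))
      where
      conclude : (∃ λ Q → Q ∈ partsOf vs cs × contents P ≡ contents Q) → P ∈ partsOf vs cs
      conclude (Q , Q∈ , eq) = subst (_∈ partsOf vs cs) (sym (contents-injective {P = P} {Q} eq)) Q∈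

-- The graph of `F` gives the lower bound. If ex(n,C₄) were larger, a graph attaining it would
-- satisfy `OneCycle` vacuously, and `Acceptable` would find a C₄ in it.
ex≡turán : Acceptable n → threshold n ≤ suc (turán n) →
           (F : Tri Bool n) → Exhaustive F [] → #edges F ≡ turán n → ex n C₄ ≡ turán n
ex≡turán {n} acc t≤ F exhaustive F-edges = ℕ.≤-antisym upper-bound
  (subst (_≤ ex n C₄) (trans (size-graph F) F-edges) (ex-upper C₄ (graph F) free))
  where
  free : Free C₄ (graph F)
  free = exhaustive⇒free F exhaustive

  upper-bound : ex n C₄ ≤ turán n
  upper-bound with ex n C₄ ≤? turán n
  ... | yes le = le
  ... | no  gt = absurd (ex-attained C₄ (graph F) free)
    where
    absurd : ∃[ G ] Free C₄ G × size {n} G ≡ ex n C₄ → _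
    absurd (G , G-free , size≡) = contradiction
      (proj₂ (acc (matrix-simple G) (λ f _ fc → ⊥-elim (no-cycle (f , fc)))
                  (ℕ.≤-trans t≤ many) many))
      no-cycle
      where
      many : turán n < edges (matrix G)
      many = subst (turán n <_) (trans (sym size≡) (size≡edges G)) (ℕ.≰⇒> gt)

      no-cycle : ¬ HasCycle (matrix G)
      no-cycle (f , fc) = G-free (cyclePart f (proj₁ fc) , cyclePart-copy G f fc)

copies≥2 : ∀ {n} → Acceptable n → 12 ≤ n → threshold n ≤ suc (turán n) → (G : Graph n) →
           size G ≡ turán n + 1 → 2 ≤ #copies C₄ G
copies≥2 {n} acc 12≤n t≤ G size≡ with 2 ≤? #copies C₄ G
... | yes le = le
... | no  gt = contradiction 12≤n (ℕ.<⇒≱ (proj₁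
  (acc (matrix-simple G) (copies≤1⇒oneCycle G (s≤s⁻¹ (ℕ.≰⇒> gt))) (ℕ.≤-trans t≤ many) many)))
  where
  many : turán n < edges (matrix G)
  many = ℕ.≤-reflexive (trans (ℕ.+-comm 1 (turán n)) (trans (sym size≡) (size≡edges G)))

-- The polarity graph of the projective plane of order 3, given by the planar
-- difference set {0, 1, 3, 9} modulo 13, with an additional edge from x to y.
-- Its vertices are ordered such that the first n of them span a C₄-free graph
-- with turán n edges; x = y = 13 adds no edge.
polarity : (n x y : ℕ) → Tri Bool n
polarity n x y = toTri λ i j → joined (label i) (label j)
  where
  label : Fin n → ℕ
  label i = nth (Fin.toℕ i) (12 ∷ 11 ∷ 10 ∷ 9 ∷ 5 ∷ 4 ∷ 3 ∷ 6 ∷ 7 ∷ 2 ∷ 8 ∷ 1 ∷ 0 ∷ [])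

  inDifferenceSet : ℕ → Bool
  inDifferenceSet k = Bool.any (k ≡ᵇ_) (0 ∷ 1 ∷ 3 ∷ 9 ∷ [])

  joined : ℕ → ℕ → Bool
  joined k l = inDifferenceSet ((k + l) % 13) ∨ ((k ≡ᵇ x) ∧ (l ≡ᵇ y)) ∨ ((k ≡ᵇ y) ∧ (l ≡ᵇ x))

-- The ends `x` and `y` of the added edge are labels modulo 13, whereas `vs` holds positions. By
-- `threshold≤`, graphs with `turán n + 1` edges fall under `Acceptable`.
record Witness (n : ℕ) (k : ℕ) : Set where
  field
    threshold≤ : threshold n ≤ suc (turán n)
    free       : Exhaustive (polarity n 13 13) []
    free-edges : #edges (polarity n 13 13) ≡ turán n
    x y        : ℕ
    vs         : List (Vec (Fin n) 4)
    cycles     : Cycles (polarity n x y) vs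
    length≡    : length vs ≡ k
    edges≡     : #edges (polarity n x y) ≡ turán n + 1

module _ {n k : ℕ} (acc : Acceptable n) (w : Witness n k) where

  open Witness w

  private
    value : ex n C₄ ≡ turán n
    value = ex≡turán acc threshold≤ (polarity n 13 13) free free-edges

  attained : ∃[ G ] (size {n} G ≡ ex n C₄ + 1 × #copies C₄ G ≡ k)
  attained = graph (polarity n x y)
    , trans (size-graph (polarity n x y)) (trans edges≡ (cong (_+ 1) (sym value)))
    , trans (#copies≡length (polarity n x y) cycles) length≡

  minimal : 12 ≤ n → ∀ j → ∃[ G ] (size {n} G ≡ ex n C₄ + 1 × #copies C₄ G ≡ j) → 2 ≤ j
  minimal 12≤n j (G , size≡ , copies≡) = subst (2 ≤_) copies≡
    (copies≥2 acc 12≤n threshold≤ G (trans size≡ (cong (_+ 1) value)))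

witness : ∀ n x y vs →
          {True (threshold n ≤? suc (turán n))} →
          {True (exhaustive? (polarity n 13 13) [])} →
          {True (#edges (polarity n 13 13) ≟ turán n)} →
          {True (cycles? (polarity n x y) vs)} →
          {True (#edges (polarity n x y) ≟ turán n + 1)} →
          Witness n (length vs)
witness n x y vs {t} {f} {e} {c} {e′} = record
  { threshold≤ = toWitness t
  ; free       = toWitness f
  ; free-edges = toWitness e
  ; x = x ; y = y ; vs = vs
  ; cycles     = toWitness c
  ; length≡    = refl
  ; edges≡     = toWitness e′
  }

-- Labels 11, 9, 4, 5. The added edge 11 9 closes a C₄ with each path of length 3 between its ends.
-- In the full polarity graph these are 11 5 4 9, 11 2 7 9 and 11 3 0 9; the second is present from
-- n = 10 on and the third only for n = 13, so one C₄ arises up to n = 9.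
square₁ : Vec (Fin (6 + n)) 4
square₁ = Fin.# 1 ∷ Fin.# 3 ∷ Fin.# 5 ∷ Fin.# 4 ∷ []

-- Labels 9, 5, 8, 7. The added edge joins the absolute points 7 and 8, whose doubles 1 and 3 modulo
-- 13 lie in the difference set. Counting loops, two unjoined points have 4 walks of length 3
-- between them; here 7 7 6 8 and 7 6 8 8 use loops, and only the paths 7 9 5 8 and 7 2 1 8 close a
-- C₄.
square₂ : Vec (Fin (11 + n)) 4
square₂ = Fin.# 3 ∷ Fin.# 4 ∷ Fin.# 10 ∷ Fin.# 8 ∷ []

-- Labels 7, 2, 1, 8. Label 1 has position 11, so this second C₄ is absent for n = 11.
square₃ : Vec (Fin (12 + n)) 4
square₃ = Fin.# 8 ∷ Fin.# 9 ∷ Fin.# 11 ∷ Fin.# 10 ∷ []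

opaque
  witness-6 : Witness 6 1
  witness-6 = witness 6 11 9 (square₁ ∷ [])

  witness-7 : Witness 7 1
  witness-7 = witness 7 11 9 (square₁ ∷ [])

  witness-8 : Witness 8 1
  witness-8 = witness 8 11 9 (square₁ ∷ [])

  witness-9 : Witness 9 1
  witness-9 = witness 9 11 9 (square₁ ∷ [])

  witness-10 : Witness 10 1
  -- The edge 11 9 would now close two copies of C₄. Between 5 and 3 only the path 5 4 10 3 is
  -- present: 5 8 6 3 and 5 9 0 3 pass through the labels 8 and 0, at positions 10 and 12.
  witness-10 = witness 10 5 3 ((Fin.# 2 ∷ Fin.# 5 ∷ Fin.# 4 ∷ Fin.# 6 ∷ []) ∷ [])

  witness-11 : Witness 11 1
  witness-11 = witness 11 7 8 (square₂ ∷ [])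

  witness-12 : Witness 12 2
  witness-12 = witness 12 7 8 (square₂ ∷ square₃ ∷ [])

  witness-13 : Witness 13 2
  witness-13 = witness 13 7 8 (square₂ ∷ square₃ ∷ [])

theorem5 : (∀ n → 6 ≤ n → n ≤ 11 →
    ∃[ G ] (size {n} G ≡ ex n C₄ + 1 × #copies C₄ G ≡ 1))
    × (∀ n → n ≡ 12 ⊎ n ≡ 13 →
    IsMinimum (λ k → ∃[ G ] (size {n} G ≡ ex n C₄ + 1 × #copies C₄ G ≡ k)) 2)
theorem5 with acceptable-from-1
... | _ , _ , _ , _ , _ , a₆ , a₇ , a₈ , a₉ , a₁₀ , a₁₁ , a₁₂ , a₁₃ =
    (λ n 6≤n n≤11 → subst UniqueCopy (ℕ.m+[n∸m]≡n 6≤n) (unique (n ∸ 6) (ℕ.∸-monoˡ-≤ 6 n≤11)))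
  , λ { _ (inj₁ refl) → attained a₁₂ witness-12 , minimal a₁₂ witness-12 ℕ.≤-refl
      ; _ (inj₂ refl) → attained a₁₃ witness-13 , minimal a₁₃ witness-13 (ℕ.n≤1+n 12) }
  where
  UniqueCopy : ℕ → Set
  UniqueCopy n = ∃[ G ] (size {n} G ≡ ex n C₄ + 1 × #copies C₄ G ≡ 1)

  unique : ∀ k → k ≤ 5 → UniqueCopy (6 + k)
  unique 0 _ = attained a₆ witness-6
  unique 1 _ = attained a₇ witness-7
  unique 2 _ = attained a₈ witness-8
  unique 3 _ = attained a₉ witness-9
  unique 4 _ = attained a₁₀ witness-10
  unique 5 _ = attained a₁₁ witness-11
  unique (suc (suc (suc (suc (suc (suc _)))))) (s≤s (s≤s (s≤s (s≤s (s≤s ())))))
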